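{- Let $a\ge 1$, $b\ge 0$ and $c\ge 2$ be integers and put $n=a+b+c-1$. Let $G=P^b(K_a,C_c)$ be the graph obtained from disjoint copies of the complete graph $K_a$ and the cycle $C_c$ by joining a vertex of $K_a$ and a vertex of $C_c$ by a path of length $b$ (for $b=0$ these two vertices are identified). Then \[ X_{G}=(a-1)!\sum_{K\vDash n} c_K\, w_K\, e_K, \] where, for a composition $K=k_1k_2\dotsm k_l\vDash n$, \[ c_K=\begin{cases} 0, & \text{if } \ell(K)\ge 2 \text{ and } k_2<a,\\[2pt] \displaystyle k_2-a-b+\frac{k_2-k_1}{k_2-1}, & \text{if } k_1\le a-1 \text{ and } k_2\ge a+b,\\[4pt] \Theta_K(a+b), & \text{otherwise}, \end{cases} \] and this expansion is positive, i.e., $c_Kw_K\ge 0$ for every $K\vDash n$. As a consequence, $X_G$ is $e$-positive.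
   Context: All graphs are finite; the chromatic symmetric function of a graph $G$ is $X_G=\sum_{\kappa}\prod_{v\in V(G)}x_{\kappa(v)}$, summed over proper colorings $\kappa:V(G)\to\{1,2,3,\dots\}$. $e_k$ denotes the $k$-th elementary symmetric function, $e_0=1$. The cycle $C_2$ is understood as its underlying simple graph $K_2$, so $P^b(K_a,C_2)$ is a simple graph (a clique with a tail). A composition $K=k_1\dotsm k_l\vDash n$ is a sequence of positive integers with sum $n$; $\ell(K)=l$ is its length. For a composition $K$, $e_K=e_{k_1}e_{k_2}\dotsm e_{k_l}$ and $w_K=k_1(k_2-1)(k_3-1)\dotsm(k_l-1)$. For a number $t$, $\sigma_K(t)=\min\{k_1+\dots+k_j: 0\le j\le \ell(K),\ k_1+\dots+k_j\ge t\}$ and $\Theta_K(t)=\sigma_K(t)-t$. An expansion $f=\sum_{K\vDash n}d_Ke_K$ means $f=\sum_{\lambda\vdash n}\big(\sum_{K \text{ rearranging to }\lambda}d_K\big)e_\lambda$; a symmetric function is $e$-positive if all its coefficients in the basis $\{e_\lambda\}$ are nonnegative. -}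

module Defs where

open import Data.Bool using (Bool; true; false; _∧_; _∨_; not; if_then_else_)
open import Data.Nat as ℕ using (ℕ; zero; suc; _+_; _*_; _∸_; _≤ᵇ_; _<ᵇ_; _≡ᵇ_)
open import Data.Integer as ℤ using (ℤ; +_)
open import Data.Rational as ℚ using (ℚ; 0ℚ; 1ℚ; _/_)
open import Data.Fin using (Fin; toℕ)
open import Data.Vec as V using (Vec; []; _∷_; lookup; tabulate; zipWith)
open import Data.List as L using (List; []; _∷_; _++_; map; concatMap; allFin; upTo; length; foldr)

ℕtoℚ : ℕ → ℚ
ℕtoℚ m = + m / 1

-- p / d as a rational; the value for d = 0 is an (unused) dummy 0.
frac : ℤ → ℕ → ℚ
frac p zero    = 0ℚ
frac p (suc d) = p / suc d

Σℚ : List ℚ → ℚ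
Σℚ = foldr ℚ._+_ 0ℚ

filterᵇ : {A : Set} → (A → Bool) → List A → List A
filterᵇ p []       = []
filterᵇ p (x ∷ xs) = if p x then x ∷ filterᵇ p xs else filterᵇ p xs

allᵇ : {A : Set} → (A → Bool) → List A → Bool
allᵇ p = foldr (λ x r → p x ∧ r) true

eqVecᵇ : {N : ℕ} → Vec ℕ N → Vec ℕ N → Bool
eqVecᵇ []       []       = true
eqVecᵇ (x ∷ xs) (y ∷ ys) = (x ≡ᵇ y) ∧ eqVecᵇ xs ys

-- Compositions (lists of positive naturals).
-- comps n enumerates every composition of n exactly once:
-- a composition of n+1 either starts with 1 (followed by a composition
-- of n) or is obtained from a composition k∷K of n by replacing k by k+1.

incrFirst : List (List ℕ) → List (List ℕ)
incrFirst []             = []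
incrFirst ([] ∷ Ks)      = incrFirst Ks
incrFirst ((k ∷ K) ∷ Ks) = (suc k ∷ K) ∷ incrFirst Ks

comps : ℕ → List (List ℕ)
comps zero    = [] ∷ []
comps (suc n) = map (1 ∷_) (comps n) ++ incrFirst (comps n)

decreasingᵇ : List ℕ → Bool
decreasingᵇ []           = true
decreasingᵇ (x ∷ [])     = true
decreasingᵇ (x ∷ y ∷ xs) = (y ≤ᵇ x) ∧ decreasingᵇ (y ∷ xs)

partitions : ℕ → List (List ℕ)
partitions n = filterᵇ decreasingᵇ (comps n)

-- Polynomials in N variables x_0,…,x_{N-1} with rational coefficients,
-- represented by their coefficient function on exponent vectors.

Poly : ℕ → Set
Poly N = Vec ℕ N → ℚ

below : {N : ℕ} → Vec ℕ N → List (Vec ℕ N)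
below []      = [] ∷ []
below (a ∷ α) = concatMap (λ i → map (i ∷_) (below α)) (upTo (suc a))

_·_ : {N : ℕ} → Poly N → Poly N → Poly N
(p · q) α = Σℚ (map (λ β → p β ℚ.* q (zipWith _∸_ α β)) (below α))

oneP : {N : ℕ} → Poly N
oneP α = if allᵇ (λ x → x ≡ᵇ 0) (V.toList α) then 1ℚ else 0ℚ

-- elementary symmetric polynomial e_k(x_0,…,x_{N-1}):
-- coefficient 1 on squarefree monomials of degree k, 0 otherwise
eP : {N : ℕ} → ℕ → Poly N
eP k α = if allᵇ (λ x → x ≤ᵇ 1) (V.toList α) ∧ (V.sum α ≡ᵇ k) then 1ℚ else 0ℚ

eComp : {N : ℕ} → List ℕ → Poly N
eComp K = foldr (λ k p → eP k · p) oneP K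

-- The graph G = P^b(K_a, C_c) on vertex set {0,…,n-1}, n = a+b+c-1:
--   * vertices 0,…,a-1 form the clique K_a;
--   * a-1, a, …, a+b-1 is the path of length b (for b = 0 the clique
--     vertex a-1 is the cycle vertex);
--   * a+b-1, a+b, …, a+b+c-2 is the cycle C_c (consecutive vertices
--     adjacent, plus the closing edge {a+b-1, a+b+c-2}; for c = 2 this
--     closing edge coincides with the edge {a+b-1,a+b}, giving K_2).

nVert : ℕ → ℕ → ℕ → ℕ
nVert a b c = a + b + c ∸ 1

-- edge between i < j (as natural numbers)
edgeᵇ : ℕ → ℕ → ℕ → ℕ → ℕ → Bool
edgeᵇ a b c i j =
  (j <ᵇ a)
  ∨ ((a ∸ 1 ≤ᵇ i) ∧ (j ≡ᵇ suc i))
  ∨ ((i ≡ᵇ a + b ∸ 1) ∧ (j ≡ᵇ a + b + c ∸ 2))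

adjᵇ : (a b c : ℕ) → Fin (nVert a b c) → Fin (nVert a b c) → Bool
adjᵇ a b c u v =
  ((toℕ u <ᵇ toℕ v) ∧ edgeᵇ a b c (toℕ u) (toℕ v))
  ∨ ((toℕ v <ᵇ toℕ u) ∧ edgeᵇ a b c (toℕ v) (toℕ u))

-- Chromatic symmetric function, restricted to N variables x_0,…,x_{N-1}:
-- [x^α] X_G(x_0,…,x_{N-1}) = #{ proper κ : V(G) → {0,…,N-1} with
--                               |κ^{-1}(i)| = α_i for all i }.

allMaps : (N m : ℕ) → List (Vec (Fin N) m)
allMaps N zero    = [] ∷ []
allMaps N (suc m) = concatMap (λ x → map (x ∷_) (allMaps N m)) (allFin N)

properᵇ : (a b c : ℕ) {N : ℕ} → Vec (Fin N) (nVert a b c) → Bool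
properᵇ a b c κ =
  allᵇ (λ u → allᵇ (λ v →
      not (adjᵇ a b c u v) ∨ not (toℕ (lookup κ u) ≡ᵇ toℕ (lookup κ v)))
    (allFin (nVert a b c))) (allFin (nVert a b c))

content : {N m : ℕ} → Vec (Fin N) m → Vec ℕ N
content {N} κ = tabulate (λ i →
  length (filterᵇ (λ c → toℕ c ≡ᵇ toℕ i) (V.toList κ)))

XG : (a b c N : ℕ) → Poly N
XG a b c N α = ℕtoℚ (length (filterᵇ
  (λ κ → properᵇ a b c κ ∧ eqVecᵇ (content κ) α)
  (allMaps N (nVert a b c))))

prodMinus1 : List ℕ → ℕ
prodMinus1 = foldr (λ k r → (k ∸ 1) * r) 1

-- w_K = k_1 (k_2-1)⋯(k_l-1)   (dummy value 1 for the empty composition)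
wK : List ℕ → ℕ
wK []      = 1
wK (k ∷ K) = k * prodMinus1 K

-- σ_K(t) = least partial sum k_1+…+k_j (0 ≤ j ≤ l) that is ≥ t
-- (the clause for t > |K| is a dummy, never used below since t ≤ n)
σK : List ℕ → ℕ → ℕ
σK K       zero    = 0
σK []      (suc t) = 0
σK (k ∷ K) (suc t) = k + σK K (suc t ∸ k)

ΘK : List ℕ → ℕ → ℕ
ΘK K t = σK K t ∸ t

cK : ℕ → ℕ → List ℕ → ℚ
cK a b (k₁ ∷ k₂ ∷ K) =
  if k₂ <ᵇ a then 0ℚ
  else if (k₁ ≤ᵇ a ∸ 1) ∧ (a + b ≤ᵇ k₂)
    then (ℤtoℚ (+ k₂ ℤ.- + a ℤ.- + b) ℚ.+ frac (+ k₂ ℤ.- + k₁) (k₂ ∸ 1))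
    else ℕtoℚ (ΘK (k₁ ∷ k₂ ∷ K) (a + b))
  where
  ℤtoℚ : ℤ → ℚ
  ℤtoℚ z = z / 1
cK a b K = ℕtoℚ (ΘK K (a + b))

{-# OPTIONS --safe #-}
-- For a colour y let u_k(y) = x_y e_{k-1}(the variables other than x_y).  Colouring the clique contributes
-- (a-1)! u_a to the weights indexed by the colour of its last vertex, and lengthening a path by one vertex acts on
-- such weights by an operator with u_k ↦ u_{k+1} + (k-1) e_k u_1.  Iterating on k expands paths over compositions.
-- A cycle is a path with distinct end colours, and inclusion-exclusion on the equality of the end colours
-- gives a recurrence in c for cycles with a tail; it matches Θ_K(t) - Θ_K(t+1) = 1 - (the part following t
-- if t is a partial sum of K), which settles a = 1.
-- Each step of the induction on a subtracts (a-1) e_a times a shorter graph of the case a = 1, that is, inserts a as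
-- second part of a composition: this cancels all K with k_2 < a except for a remainder supported on k_1 ≥ a + b,
-- and interchanging k_1 and k_2 in the remainder produces the exceptional coefficient.
module Submission where

open import Defs
open import Algebra.Bundles using (CommutativeMonoid; CommutativeRing)
open import Data.Bool using (Bool; true; false; _∧_; _∨_; not; if_then_else_; T)
open import Data.Bool.Properties using (∧-assoc; ∧-idem; ∧-zeroʳ; ∧-conicalˡ; ∧-conicalʳ; ∨-identityʳ; ∧-commutativeMonoid)
open import Data.Fin using (Fin; zero; suc; toℕ)
open import Data.Fin.Properties using (_≟_)
open import Data.Integer as ℤ using (+_)
import Data.Integer.Properties as ℤₚ
import Data.Integer.Tactic.RingSolver as ℤ-Solver
open import Data.List using (List; []; _∷_; _++_; map; foldr; length; concatMap; upTo; applyUpTo; allFin; tabulate)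
open import Data.List.Membership.Propositional using (_∈_)
open import Data.List.Properties using (≡-dec; map-∘; map-applyUpTo)
import Data.List.Relation.Binary.Permutation.Propositional as ↭
open import Data.List.Relation.Unary.All as All using (All; []; _∷_)
import Data.List.Relation.Unary.All.Properties as Allₚ
open import Data.List.Relation.Unary.Linked using (Linked; []; [-]; _∷_)
import Data.List.Sort
open import Data.Nat as ℕ using (ℕ; zero; suc; z≤n; s≤s; _≤_; _∸_; _!; _<ᵇ_; _≡ᵇ_; _≤ᵇ_; _≤?_)
import Data.Nat.Properties as ℕₚ
open import Data.Nat.Tactic.RingSolver using (solve-∀)
open import Data.Product using (Σ; ∃; _,_; _×_)
open import Data.Rational as ℚ using (ℚ; 0ℚ; 1ℚ; _/_; toℚᵘ)
import Data.Rational.Properties as ℚₚ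
import Data.Rational.Solver as ℚ-Solver
import Data.Rational.Unnormalised as ℚᵘ
import Data.Rational.Unnormalised.Properties as ℚᵘₚ
open import Data.Sum using (_⊎_; inj₁; inj₂)
open import Data.Vec as V using (Vec; []; _∷_; zipWith; lookup; updateAt)
open import Data.Vec.Properties using (tabulate-cong)
open import Function using (_∘_; id)
open import Level using (0ℓ)
open import Relation.Binary.Construct.Flip.EqAndOrd using (decTotalOrder)
open import Relation.Binary.Definitions using (tri<; tri≈; tri>)
open import Relation.Binary.PropositionalEquality as ≡ using (_≡_; _≢_; cong; cong₂; module ≡-Reasoning)
import Relation.Binary.Reasoning.Setoid as SetoidReasoning
open import Relation.Nullary using (Dec; does; yes; no; contradiction)

open ↭ using (_↭_)
open Data.List.Sort (decTotalOrder ℕₚ.≤-decTotalOrder) using (sort; sort-↭; sort-↗)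

-- Finite sums

-- One operation lies behind both the path recurrence and the induction on a. The weight w_K uses
-- its second part only through k_2 - 1, so multiplying an expansion with weights w by (k-1) e_k
-- amounts to inserting k as second part, whatever the first part is. Hence compositions are
-- enumerated by their second part as well as by their first. The induction on a subtracts, so
-- positivity is not visible along the way. The negative remainder sits on K with k_1 ≥ a+b and k_2
-- < a, where the kept coefficient is 0. As e_K does not change when k_1 and k_2 are exchanged, the
-- remainder can be charged to compositions with k_1 < a and k_2 ≥ a+b, where Θ_K(a+b) = k_1+k_2-a-b
-- is large enough to absorb it. Coefficients stay natural numbers: each difference is stated with
-- its negative terms moved to the other side, and common terms are cancelled in the ring. The
-- weights are computed for arbitrary elements X of a commutative ring; polynomials enter only to
-- count colourings by content.

module Antidiagonal {c ℓ} (M : CommutativeMonoid c ℓ) where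

  open CommutativeMonoid M
  open SetoidReasoning setoid
  open import Algebra.Properties.CommutativeSemigroup commutativeSemigroup using (interchange)

  -- Passing the complementary index r along with i keeps truncated subtraction out of sums over i +
  -- r = n.
  anti : ℕ → (ℕ → ℕ → Carrier) → Carrier
  anti zero    h = h 0 0
  anti (suc n) h = h 0 (suc n) ∙ anti n (λ i r → h (suc i) r)

  anti-cong : ∀ n {h k : ℕ → ℕ → Carrier} → (∀ i r → i ℕ.+ r ≡ n → h i r ≈ k i r) → anti n h ≈ anti n k
  anti-cong zero    eq = eq 0 0 ≡.refl
  anti-cong (suc n) eq = ∙-cong (eq 0 (suc n) ≡.refl) (anti-cong n (λ i r p → eq (suc i) r (≡.cong suc p)))

  anti-ε : ∀ n {h : ℕ → ℕ → Carrier} → (∀ i r → h i r ≈ ε) → anti n h ≈ ε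
  anti-ε zero    eq = eq 0 0
  anti-ε (suc n) eq = trans (∙-cong (eq 0 (suc n)) (anti-ε n (λ i r → eq (suc i) r))) (identityˡ ε)

  anti-∙ : ∀ n (h k : ℕ → ℕ → Carrier) → anti n (λ i r → h i r ∙ k i r) ≈ anti n h ∙ anti n k
  anti-∙ zero    h k = refl
  anti-∙ (suc n) h k = trans (∙-congˡ (anti-∙ n _ _)) (interchange _ _ _ _)

  anti-homo : (φ : Carrier → Carrier) → (∀ x y → φ (x ∙ y) ≈ φ x ∙ φ y) →
              ∀ n h → φ (anti n h) ≈ anti n (λ i r → φ (h i r))
  anti-homo φ φ-∙ zero    h = refl
  anti-homo φ φ-∙ (suc n) h = trans (φ-∙ _ _) (∙-congˡ (anti-homo φ φ-∙ n _))

  anti-splitLast : ∀ n h → anti (suc n) h ≈ anti n (λ i r → h i (suc r)) ∙ h (suc n) 0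
  anti-splitLast zero    h = refl
  anti-splitLast (suc n) h = trans (∙-congˡ (anti-splitLast n (λ i r → h (suc i) r))) (sym (assoc _ _ _))

  anti-flip : ∀ n h → anti n h ≈ anti n (λ i r → h r i)
  anti-flip zero    h = refl
  anti-flip (suc n) h = begin
    h 0 (suc n) ∙ anti n (λ i r → h (suc i) r)  ≈⟨ comm _ _ ⟩
    anti n (λ i r → h (suc i) r) ∙ h 0 (suc n)  ≈⟨ ∙-congʳ (anti-flip n _) ⟩
    anti n (λ i r → h (suc r) i) ∙ h 0 (suc n)  ≈⟨ anti-splitLast n (λ i r → h r i) ⟨
    anti (suc n) (λ i r → h r i)                ∎

  anti-shift : ∀ n (h k : ℕ → ℕ → Carrier) → (∀ j → k j 0 ≈ ε) → (∀ j r → k j (suc r) ≈ h j r) →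
               anti (suc n) k ≈ anti n h
  anti-shift n h k k0 ks = begin
    anti (suc n) k                              ≈⟨ anti-splitLast n k ⟩
    anti n (λ i r → k i (suc r)) ∙ k (suc n) 0  ≈⟨ ∙-cong (anti-cong n (λ i r _ → ks i r)) (k0 (suc n)) ⟩
    anti n h ∙ ε                                ≈⟨ identityʳ _ ⟩
    anti n h                                    ∎

  private
    rest : (ℕ → ℕ → Carrier) → ℕ → Carrier
    rest h zero    = ε
    rest h (suc r) = anti r (λ i s → h (suc i) s)

    anti-head : ∀ r h → anti r h ≈ h 0 r ∙ rest h r
    anti-head zero    h = sym (identityʳ _)
    anti-head (suc r) h = refl

  -- Both sides run over all i + j + s = n. Splitting off i = 0 on the left leaves a sum with i ≥ 1,
  -- which on the right is the `rest` of the inner sums.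
  anti-swap : ∀ n (g : ℕ → ℕ → ℕ → Carrier) →
              anti n (λ i r → anti r (λ j s → g i j s)) ≈ anti n (λ j r → anti r (λ i s → g i j s))
  anti-swap zero    g = refl
  anti-swap (suc n) g = begin
    anti (suc n) (g 0) ∙ anti n (λ i r → anti r (λ j s → g (suc i) j s))
      ≈⟨ ∙-congˡ (anti-swap n (λ i → g (suc i))) ⟩
    anti (suc n) (g 0) ∙ anti n (λ j r → anti r (λ i s → g (suc i) j s))
      ≈⟨ ∙-congˡ (anti-shift n _ (λ j r → rest (λ i s → g i j s) r) (λ j → refl) (λ j r → refl)) ⟨
    anti (suc n) (g 0) ∙ anti (suc n) (λ j r → rest (λ i s → g i j s) r)
      ≈⟨ anti-∙ (suc n) (g 0) (λ j r → rest (λ i s → g i j s) r) ⟨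
    anti (suc n) (λ j r → g 0 j r ∙ rest (λ i s → g i j s) r)
      ≈⟨ anti-cong (suc n) (λ j r _ → sym (anti-head r (λ i s → g i j s))) ⟩
    anti (suc n) (λ j r → anti r (λ i s → g i j s)) ∎

  anti-pick : ∀ i r h → (∀ j s → j ≢ i → h j s ≈ ε) → anti (i ℕ.+ r) h ≈ h i r
  anti-pick zero    zero    h off = refl
  anti-pick zero    (suc r) h off = trans (∙-congˡ (anti-ε r (λ j s → off (suc j) s λ ()))) (identityʳ _)
  anti-pick (suc i) r       h off = begin
    h 0 (suc (i ℕ.+ r)) ∙ anti (i ℕ.+ r) (λ j s → h (suc j) s)
      ≈⟨ ∙-cong (off 0 _ λ ()) (anti-pick i r _ (λ j s j≢i → off (suc j) s (j≢i ∘ ℕₚ.suc-injective))) ⟩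
    ε ∙ h (suc i) r  ≈⟨ identityˡ _ ⟩
    h (suc i) r      ∎

  anti-truncate : ∀ n m h → (∀ i r → n ℕ.< i → h i r ≈ ε) →
                  anti (n ℕ.+ m) h ≈ anti n (λ i r → h i (r ℕ.+ m))
  anti-truncate zero    zero    h off = refl
  anti-truncate zero    (suc m) h off = trans (∙-congˡ (anti-ε m (λ i r → off (suc i) r (s≤s z≤n)))) (identityʳ _)
  anti-truncate (suc n) m       h off = ∙-congˡ (anti-truncate n m _ (λ i r n<i → off (suc i) r (s≤s n<i)))

module ListSum {c ℓ} (M : CommutativeMonoid c ℓ) where

  open CommutativeMonoid M
  open import Algebra.Properties.CommutativeSemigroup commutativeSemigroup using (interchange)

  Σ[_] : ∀ {a} {A : Set a} → (A → Carrier) → List A → Carrier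
  Σ[ f ] xs = foldr _∙_ ε (map f xs)

  module _ {a} {A : Set a} where

    Σ-cong : {f g : A → Carrier} → (∀ x → f x ≈ g x) → ∀ xs → Σ[ f ] xs ≈ Σ[ g ] xs
    Σ-cong eq []       = refl
    Σ-cong eq (x ∷ xs) = ∙-cong (eq x) (Σ-cong eq xs)

    Σ-++ : (f : A → Carrier) → ∀ xs ys → Σ[ f ] (xs ++ ys) ≈ Σ[ f ] xs ∙ Σ[ f ] ys
    Σ-++ f []       ys = sym (identityˡ _)
    Σ-++ f (x ∷ xs) ys = trans (∙-congˡ (Σ-++ f xs ys)) (sym (assoc _ _ _))

    Σ-∙ : (f g : A → Carrier) → ∀ xs → Σ[ (λ x → f x ∙ g x) ] xs ≈ Σ[ f ] xs ∙ Σ[ g ] xs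
    Σ-∙ f g []       = sym (identityˡ _)
    Σ-∙ f g (x ∷ xs) = trans (∙-congˡ (Σ-∙ f g xs)) (interchange _ _ _ _)

    Σ-ε : {f : A → Carrier} → (∀ x → f x ≈ ε) → ∀ xs → Σ[ f ] xs ≈ ε
    Σ-ε eq []       = refl
    Σ-ε eq (x ∷ xs) = trans (∙-cong (eq x) (Σ-ε eq xs)) (identityˡ ε)

    Σ-homo : (φ : Carrier → Carrier) → φ ε ≈ ε → (∀ x y → φ (x ∙ y) ≈ φ x ∙ φ y) →
             (f : A → Carrier) → ∀ xs → φ (Σ[ f ] xs) ≈ Σ[ φ ∘ f ] xs
    Σ-homo φ φ-ε φ-∙ f []       = φ-ε
    Σ-homo φ φ-ε φ-∙ f (x ∷ xs) = trans (φ-∙ _ _) (∙-congˡ (Σ-homo φ φ-ε φ-∙ f xs))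

    Σ-map : ∀ {b} {B : Set b} (f : A → Carrier) (g : B → A) → ∀ xs → Σ[ f ] (map g xs) ≡ Σ[ f ∘ g ] xs
    Σ-map f g xs = ≡.cong (foldr _∙_ ε) (≡.sym (map-∘ xs))

    Σ-concatMap : ∀ {b} {B : Set b} (f : A → Carrier) (g : B → List A) → ∀ xs →
                  Σ[ f ] (concatMap g xs) ≈ Σ[ (λ x → Σ[ f ] (g x)) ] xs
    Σ-concatMap f g []       = refl
    Σ-concatMap f g (x ∷ xs) = trans (Σ-++ f (g x) (concatMap g xs)) (∙-congˡ (Σ-concatMap f g xs))

-- Elementary symmetric functions and the transfer operator of a path

module Scalars {c ℓ} (R : CommutativeRing c ℓ) where

  open CommutativeRing R hiding (zero)
  open import Algebra.Properties.Semiring.Mult semiring using (×-homo-+; ×1-homo-*) renaming (_×_ to _·ℕ_)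

  ι : ℕ → Carrier
  ι n = n ·ℕ 1#

  ι-+ : ∀ m n → ι (m ℕ.+ n) ≈ ι m + ι n
  ι-+ = ×-homo-+ 1#

  ι-* : ∀ m n → ι (m ℕ.* n) ≈ ι m * ι n
  ι-* = ×1-homo-*

  ι-cong : ∀ {m n} → m ≡ n → ι m ≈ ι n
  ι-cong ≡.refl = refl

module Elementary {c ℓ} (R : CommutativeRing c ℓ) where

  open CommutativeRing R hiding (zero)
  open Scalars R
  open SetoidReasoning setoid
  open import Algebra.Properties.Semiring.Sum semiring
  open import Algebra.Properties.CommutativeSemigroup *-commutativeSemigroup using (x∙yz≈y∙xz)
  open import Algebra.Solver.Ring.NaturalCoefficients.Default commutativeSemiring

  -- Setting a variable to 0 deletes it from every `elem` while the index type stays `Fin N`, so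
  -- that deletions can be iterated and exchanged.
  omit : ∀ {N} → Fin N → (Fin N → Carrier) → Fin N → Carrier
  omit y v z = if does (z ≟ y) then 0# else v z

  elem : ∀ {N} → ℕ → (Fin N → Carrier) → Carrier
  elem         zero    v = 1#
  elem {zero}  (suc k) v = 0#
  elem {suc N} (suc k) v = elem (suc k) (v ∘ suc) + v zero * elem k (v ∘ suc)

  elem-cong : ∀ {N} k {v w : Fin N → Carrier} → (∀ y → v y ≈ w y) → elem k v ≈ elem k w
  elem-cong         zero    eq = refl
  elem-cong {zero}  (suc k) eq = refl
  elem-cong {suc N} (suc k) eq = +-cong (elem-cong (suc k) (eq ∘ suc)) (*-cong (eq zero) (elem-cong k (eq ∘ suc)))

  elem-omit-zero : ∀ {N} k (v : Fin (suc N) → Carrier) → elem k (omit zero v) ≈ elem k (v ∘ suc)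
  elem-omit-zero zero    v = refl
  elem-omit-zero (suc k) v = trans (+-congˡ (zeroˡ _)) (+-identityʳ _)

  elem-omit : ∀ {N} k (v : Fin N → Carrier) y → elem (suc k) v ≈ elem (suc k) (omit y v) + v y * elem k (omit y v)
  elem-omit k v zero = sym (+-cong (elem-omit-zero (suc k) v) (*-congˡ (elem-omit-zero k v)))
  elem-omit zero v (suc y) = begin
    elem 1 v′ + v zero * 1#                         ≈⟨ +-congʳ (elem-omit 0 v′ y) ⟩
    (elem 1 (omit y v′) + v′ y * 1#) + v zero * 1#
      ≈⟨ solve 3 (λ a b d → (a :+ b) :+ d := (a :+ d) :+ b) refl _ _ _ ⟩
    (elem 1 (omit y v′) + v zero * 1#) + v′ y * 1#  ∎
    where v′ = v ∘ suc
  elem-omit (suc k) v (suc y) = begin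
    elem (suc (suc k)) v′ + v zero * elem (suc k) v′
      ≈⟨ +-cong (elem-omit (suc k) v′ y) (*-congˡ (elem-omit k v′ y)) ⟩
    (E (suc (suc k)) + v′ y * E (suc k)) + v zero * (E (suc k) + v′ y * E k)
      ≈⟨ solve 5 (λ p q r x z → (p :+ x :* q) :+ z :* (q :+ x :* r) := (p :+ z :* q) :+ x :* (q :+ z :* r))
           refl (E (suc (suc k))) (E (suc k)) (E k) (v′ y) (v zero) ⟩
    (E (suc (suc k)) + v zero * E (suc k)) + v′ y * (E (suc k) + v zero * E k) ∎
    where
    v′ = v ∘ suc
    E : ℕ → Carrier
    E j = elem j (omit y v′)

  ⟨_,_⟩ : ∀ {N} → (Fin N → Carrier) → (Fin N → Carrier) → Carrier
  ⟨ v , h ⟩ = sum (λ y → v y * h y)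

  ⟨⟩-congʳ : ∀ {N} (v : Fin N → Carrier) {h k : Fin N → Carrier} → (∀ y → h y ≈ k y) → ⟨ v , h ⟩ ≈ ⟨ v , k ⟩
  ⟨⟩-congʳ v eq = sum-cong-≋ (λ y → *-congˡ (eq y))

  ⟨⟩-congˡ : ∀ {N} {v w : Fin N → Carrier} (h : Fin N → Carrier) → (∀ y → v y ≈ w y) → ⟨ v , h ⟩ ≈ ⟨ w , h ⟩
  ⟨⟩-congˡ h eq = sum-cong-≋ (λ y → *-congʳ (eq y))

  ⟨⟩-+ : ∀ {N} (v h k : Fin N → Carrier) → ⟨ v , (λ y → h y + k y) ⟩ ≈ ⟨ v , h ⟩ + ⟨ v , k ⟩
  ⟨⟩-+ {N} v h k = trans (sum-cong-≋ (λ y → distribˡ (v y) (h y) (k y))) (∑-distrib-+ {N} (λ y → v y * h y) (λ y → v y * k y))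

  ⟨⟩-scale : ∀ {N} (v h : Fin N → Carrier) x → ⟨ v , (λ y → x * h y) ⟩ ≈ x * ⟨ v , h ⟩
  ⟨⟩-scale {N} v h x = trans (sum-cong-≋ (λ y → x∙yz≈y∙xz (v y) x (h y))) (sym (*-distribˡ-sum {N} x (λ y → v y * h y)))

  ⟨omit⟩ : ∀ {N} (v h : Fin N → Carrier) y → ⟨ omit y v , h ⟩ + v y * h y ≈ ⟨ v , h ⟩
  ⟨omit⟩ v h zero    = trans (+-congʳ (trans (+-congʳ (zeroˡ _)) (+-identityˡ _))) (+-comm _ _)
  ⟨omit⟩ v h (suc y) = trans (+-assoc _ _ _) (+-congˡ (⟨omit⟩ (v ∘ suc) (h ∘ suc) y))

  -- Each product of k+1 distinct variables arises once from each of its factors.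
  elem-euler : ∀ {N} k (v : Fin N → Carrier) → ⟨ v , (λ y → elem k (omit y v)) ⟩ ≈ ι (suc k) * elem (suc k) v
  elem-euler {zero}  k       v = sym (zeroʳ _)
  elem-euler {suc N} zero    v = begin
    v zero * 1# + ⟨ v ∘ suc , (λ y → 1#) ⟩  ≈⟨ +-congˡ (elem-euler 0 (v ∘ suc)) ⟩
    v zero * 1# + ι 1 * elem 1 (v ∘ suc)
      ≈⟨ solve 2 (λ x e → x :* con 1 :+ (con 1 :+ con 0) :* e := (con 1 :+ con 0) :* (e :+ x :* con 1)) refl (v zero) (elem 1 (v ∘ suc)) ⟩
    ι 1 * (elem 1 (v ∘ suc) + v zero * 1#)  ∎
  elem-euler {suc N} (suc k) v = begin
    v zero * elem (suc k) (omit zero v) + ⟨ v′ , (λ y → E (suc k) y + v zero * E k y) ⟩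
      ≈⟨ +-cong (*-congˡ (elem-omit-zero (suc k) v)) (⟨⟩-+ v′ (E (suc k)) (λ y → v zero * E k y)) ⟩
    v zero * e₁ + (⟨ v′ , E (suc k) ⟩ + ⟨ v′ , (λ y → v zero * E k y) ⟩)
      ≈⟨ +-congˡ (+-congˡ (⟨⟩-scale v′ (E k) (v zero))) ⟩
    v zero * e₁ + (⟨ v′ , E (suc k) ⟩ + v zero * ⟨ v′ , E k ⟩)
      ≈⟨ +-congˡ (+-cong (elem-euler (suc k) v′) (*-congˡ (elem-euler k v′))) ⟩
    v zero * e₁ + (ι (suc (suc k)) * e₂ + v zero * (ι (suc k) * e₁))
      ≈⟨ solve 4 (λ x p q i → x :* p :+ ((con 1 :+ i) :* q :+ x :* (i :* p)) := (con 1 :+ i) :* (q :+ x :* p)) refl (v zero) e₁ e₂ (ι (suc k)) ⟩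
    ι (suc (suc k)) * (e₂ + v zero * e₁) ∎
    where
    v′ = v ∘ suc
    e₁ = elem (suc k) v′
    e₂ = elem (suc (suc k)) v′
    E : ℕ → Fin N → Carrier
    E j y = elem j (omit y v′)


module Transfer {c ℓ} (R : CommutativeRing c ℓ) {N : ℕ} (X : Fin N → CommutativeRing.Carrier R) where

  open CommutativeRing R hiding (zero)
  open Scalars R
  open Elementary R
  open SetoidReasoning setoid
  open import Algebra.Properties.Group +-group using () renaming (∙-cancelʳ to +-cancelʳ)
  open import Algebra.Solver.Ring.NaturalCoefficients.Default commutativeSemiring

  Fun : Set c
  Fun = Fin N → Carrier

  -- Here h z is the weight of what hangs on a vertex coloured z, the weight of that vertex
  -- excluded. A new neighbour coloured y collects x_z h(z) over all z ≠ y.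
  step : Fun → Fun
  step h y = ⟨ omit y X , h ⟩

  pow : ℕ → Fun → Fun
  pow zero    h = h
  pow (suc n) h = step (pow n h)

  one : Fun
  one y = 1#

  pow-cong : ∀ n {h k : Fun} → (∀ y → h y ≈ k y) → ∀ y → pow n h y ≈ pow n k y
  pow-cong zero    eq   = eq
  pow-cong (suc n) eq y = ⟨⟩-congʳ (omit y X) (pow-cong n eq)

  pow-linear : ∀ n (h k : Fun) x y → pow n (λ z → h z + x * k z) y ≈ pow n h y + x * pow n k y
  pow-linear zero    h k x y = refl
  pow-linear (suc n) h k x y = begin
    ⟨ omit y X , pow n (λ z → h z + x * k z) ⟩
      ≈⟨ ⟨⟩-congʳ (omit y X) (pow-linear n h k x) ⟩
    ⟨ omit y X , (λ z → pow n h z + x * pow n k z) ⟩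
      ≈⟨ ⟨⟩-+ (omit y X) (pow n h) (λ z → x * pow n k z) ⟩
    step (pow n h) y + ⟨ omit y X , (λ z → x * pow n k z) ⟩
      ≈⟨ +-congˡ (⟨⟩-scale (omit y X) (pow n k) x) ⟩
    step (pow n h) y + x * step (pow n k) y ∎

  pow-+ : ∀ m n h → pow m (pow n h) ≡ pow (m ℕ.+ n) h
  pow-+ zero    n h = ≡.refl
  pow-+ (suc m) n h = ≡.cong step (pow-+ m n h)

  pow-step : ∀ n h → pow n (step h) ≡ step (pow n h)
  pow-step zero    h = ≡.refl
  pow-step (suc n) h = ≡.cong step (pow-step n h)

  e : ℕ → Carrier
  e k = elem k X

  -- U k is u_{k+1}.
  U : ℕ → Fun
  U k y = X y * elem k (omit y X)

  step-X : ∀ h y → step h y + X y * h y ≈ ⟨ U 0 , h ⟩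
  step-X h y = trans (⟨omit⟩ X h y) (⟨⟩-congˡ h (λ z → sym (*-identityʳ (X z))))

  -- Pointwise this is `elem-omit` multiplied by x_y h(y): e_{k+1} splits according to whether x_y
  -- is used.
  U-X : ∀ k h → ⟨ U k , (λ y → X y * h y) ⟩ + ⟨ U (suc k) , h ⟩ ≈ e (suc k) * ⟨ U 0 , h ⟩
  U-X k h = begin
    ⟨ U k , (λ y → X y * h y) ⟩ + ⟨ U (suc k) , h ⟩
      ≈⟨ +-cong (⟨⟩-congʳ (U k) (λ y → sym (*-identityʳ _))) (⟨⟩-congˡ h (λ y → sym (*-identityʳ _))) ⟩
    ⟨ U k , (λ y → (X y * h y) * 1#) ⟩ + ⟨ (λ y → U (suc k) y * 1#) , h ⟩
      ≈⟨ ∑-distrib-+ {N} (λ y → U k y * ((X y * h y) * 1#)) (λ y → (U (suc k) y * 1#) * h y) ⟨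
    sum (λ y → U k y * ((X y * h y) * 1#) + (U (suc k) y * 1#) * h y)
      ≈⟨ sum-cong-≋ (λ y → trans
           (solve 4 (λ x p q z → (x :* p) :* ((x :* z) :* con 1) :+ ((x :* q) :* con 1) :* z := (q :+ x :* p) :* ((x :* con 1) :* z))
             refl (X y) (elem k (omit y X)) (elem (suc k) (omit y X)) (h y))
           (*-congʳ (sym (elem-omit k X y)))) ⟩
    sum (λ y → e (suc k) * (U 0 y * h y))
      ≈⟨ *-distribˡ-sum {N} (e (suc k)) (λ y → U 0 y * h y) ⟨
    e (suc k) * ⟨ U 0 , h ⟩ ∎
    where open import Algebra.Properties.Semiring.Sum semiring

  U-one : ∀ k → ⟨ U k , one ⟩ ≈ ι (suc k) * e (suc k)
  U-one k = trans (sum-cong-≋ (λ y → *-identityʳ (U k y))) (elem-euler k X)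
    where open import Algebra.Properties.Semiring.Sum semiring

  -- By `step-X`, `step h` is the constant ⟨ U 0 , h ⟩ minus x_y h(y). Euler's identity makes the
  -- constant contribute (k+1) e_{k+1} ⟨ U 0 , h ⟩, and `U-X` uses up one of these k+1 copies while
  -- producing `U (suc k)`; this leaves the factor k.
  U-step : ∀ k h → ⟨ U k , step h ⟩ ≈ ⟨ U (suc k) , h ⟩ + ι k * e (suc k) * ⟨ U 0 , h ⟩
  U-step k h = +-cancelʳ (e′ * B) _ _ (begin
    ⟨ U k , step h ⟩ + e′ * B
      ≈⟨ +-congˡ (U-X k h) ⟨
    ⟨ U k , step h ⟩ + (⟨ U k , (λ y → X y * h y) ⟩ + ⟨ U (suc k) , h ⟩)
      ≈⟨ trans (sym (+-assoc _ _ _)) (+-congʳ (sym (⟨⟩-+ (U k) (step h) (λ y → X y * h y)))) ⟩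
    ⟨ U k , (λ y → step h y + X y * h y) ⟩ + ⟨ U (suc k) , h ⟩
      ≈⟨ +-congʳ (⟨⟩-congʳ (U k) (λ y → trans (step-X h y) (sym (*-identityʳ B)))) ⟩
    ⟨ U k , (λ y → B * 1#) ⟩ + ⟨ U (suc k) , h ⟩
      ≈⟨ +-congʳ (trans (⟨⟩-scale (U k) one B) (*-congˡ (U-one k))) ⟩
    B * (ι (suc k) * e′) + ⟨ U (suc k) , h ⟩
      ≈⟨ solve 4 (λ b i x u → b :* ((con 1 :+ i) :* x) :+ u := (u :+ i :* x :* b) :+ x :* b) refl B (ι k) e′ _ ⟩
    (⟨ U (suc k) , h ⟩ + ι k * e′ * B) + e′ * B ∎)
    where
    e′ = e (suc k)
    B = ⟨ U 0 , h ⟩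

  -- The cycle C_{m+1} with base vertex coloured y, not counting the weight of the base vertex.
  D : ℕ → Fun
  D m y = pow m (omit y one) y

  omit-one : ∀ z y → X y * omit y one z ≈ omit z X y * 1#
  omit-one z y with z ≟ y | y ≟ z
  ... | yes _   | yes _   = trans (zeroʳ _) (sym (zeroˡ _))
  ... | no _    | no _    = refl
  ... | yes z≡y | no y≢z  = contradiction (≡.sym z≡y) y≢z
  ... | no z≢y  | yes y≡z = contradiction (≡.sym y≡z) z≢y

  ⟨⟩-omit : ∀ (v h : Fun) y → ⟨ v , omit y h ⟩ ≈ ⟨ omit y v , h ⟩
  ⟨⟩-omit v h y = sum-cong-≋ go
    where
    open import Algebra.Properties.Semiring.Sum semiring
    go : ∀ z → v z * omit y h z ≈ omit y v z * h z
    go z with does (z ≟ y)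
    ... | true  = trans (zeroʳ _) (sym (zeroˡ _))
    ... | false = refl

  -- Either the far end of the path avoids the colour y, or it has colour y: then its weight X y
  -- splits off and its neighbour must avoid y.
  pow-omit-one : ∀ m y z → pow (suc m) one z ≈ pow (suc m) (omit y one) z + X y * pow m (omit y one) z
  pow-omit-one zero y z = begin
    ⟨ omit z X , one ⟩                                      ≈⟨ ⟨omit⟩ (omit z X) one y ⟨
    ⟨ omit y (omit z X) , one ⟩ + omit z X y * 1#           ≈⟨ +-cong (⟨⟩-omit (omit z X) one y) (omit-one z y) ⟨
    ⟨ omit z X , omit y one ⟩ + X y * omit y one z          ∎
  pow-omit-one (suc m) y z = trans (⟨⟩-congʳ (omit z X) (pow-omit-one m y))
    (pow-linear 1 (pow (suc m) (omit y one)) (pow m (omit y one)) (X y) z)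

  -- k! L k b m and k! Q k b are the weights of P^b(K_{k+1}, C_{m+1}) and of K_{k+1} with a pendant path of length b.
  L : ℕ → ℕ → ℕ → Carrier
  L k b m = ⟨ U k , pow b (D m) ⟩

  Q : ℕ → ℕ → Carrier
  Q k b = ⟨ U k , pow b one ⟩

  -- `pow-omit-one` at z = y is the inclusion-exclusion on the end colours. Its term x_y D m y does
  -- not pass through `pow`, so `step-X` trades it for the constant `L 0 0 m` and a step. The
  -- factors 1# give both sides the shape g + x h of `pow-linear`.
  D-suc : ∀ m y → D (suc m) y + L 0 0 m * 1# ≈ pow (suc m) one y + 1# * step (D m) y
  D-suc m y = begin
    D (suc m) y + L 0 0 m * 1#                     ≈⟨ +-congˡ (trans (*-identityʳ _) (sym (step-X (D m) y))) ⟩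
    D (suc m) y + (step (D m) y + X y * D m y)     ≈⟨ solve 3 (λ a b d → a :+ (b :+ d) := (a :+ d) :+ con 1 :* b) refl (D (suc m) y) (step (D m) y) (X y * D m y) ⟩
    (D (suc m) y + X y * D m y) + 1# * step (D m) y ≈⟨ +-congʳ (pow-omit-one m y y) ⟨
    pow (suc m) one y + 1# * step (D m) y          ∎

  Q-zero : ∀ k → Q k 0 ≈ ι (suc k) * e (suc k)
  Q-zero = U-one

  Q-suc : ∀ k b → Q k (suc b) ≈ Q (suc k) b + ι k * e (suc k) * Q 0 b
  Q-suc k b = U-step k (pow b one)

  L-path : ∀ k b m → L k (suc b) m ≈ L (suc k) b m + ι k * e (suc k) * L 0 b m
  L-path k b m = U-step k (pow b (D m))

  D-zero : ∀ y → D 0 y ≈ 0#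
  D-zero y with y ≟ y
  ... | yes _  = refl
  ... | no y≢y = contradiction ≡.refl y≢y

  ⟨⟩-pow-linear : ∀ k b (g h : Fun) x → ⟨ U k , pow b (λ y → g y + x * h y) ⟩ ≈ ⟨ U k , pow b g ⟩ + x * ⟨ U k , pow b h ⟩
  ⟨⟩-pow-linear k b g h x = begin
    ⟨ U k , pow b (λ y → g y + x * h y) ⟩            ≈⟨ ⟨⟩-congʳ (U k) (pow-linear b g h x) ⟩
    ⟨ U k , (λ y → pow b g y + x * pow b h y) ⟩      ≈⟨ ⟨⟩-+ (U k) (pow b g) (λ y → x * pow b h y) ⟩
    ⟨ U k , pow b g ⟩ + ⟨ U k , (λ y → x * pow b h y) ⟩ ≈⟨ +-congˡ (⟨⟩-scale (U k) (pow b h) x) ⟩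
    ⟨ U k , pow b g ⟩ + x * ⟨ U k , pow b h ⟩        ∎

  pow-zero : ∀ b {h : Fun} → (∀ y → h y ≈ 0#) → ∀ y → pow b h y ≈ 0#
  pow-zero zero    eq   = eq
  pow-zero (suc b) {h} eq y = begin
    ⟨ omit y X , pow b h ⟩         ≈⟨ ⟨⟩-congʳ (omit y X) (λ z → trans (pow-zero b eq z) (sym (zeroˡ 0#))) ⟩
    ⟨ omit y X , (λ z → 0# * 0#) ⟩ ≈⟨ ⟨⟩-scale (omit y X) (λ z → 0#) 0# ⟩
    0# * ⟨ omit y X , (λ z → 0#) ⟩ ≈⟨ zeroˡ _ ⟩
    0#                             ∎

  L-zero : ∀ b → L 0 b 0 ≈ 0#
  L-zero b = trans (⟨⟩-congʳ (U 0) {k = λ y → 0# * 0#} (λ y → trans (pow-zero b D-zero y) (sym (zeroˡ 0#))))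
    (trans (⟨⟩-scale (U 0) (λ y → 0#) 0#) (zeroˡ _))

  -- This is `D-suc` with a tail of length b attached; the constant `L 0 0 m`, the weight of a
  -- cycle, then multiplies a free path.
  L-cycle : ∀ b m → L 0 b (suc m) + L 0 0 m * Q 0 b ≈ Q 0 (b ℕ.+ suc m) + L 0 (suc b) m
  L-cycle b m = begin
    L 0 b (suc m) + L 0 0 m * Q 0 b
      ≈⟨ ⟨⟩-pow-linear 0 b (D (suc m)) one (L 0 0 m) ⟨
    ⟨ U 0 , pow b (λ y → D (suc m) y + L 0 0 m * 1#) ⟩
      ≈⟨ ⟨⟩-congʳ (U 0) (pow-cong b (D-suc m)) ⟩
    ⟨ U 0 , pow b (λ y → pow (suc m) one y + 1# * step (D m) y) ⟩
      ≈⟨ ⟨⟩-pow-linear 0 b (pow (suc m) one) (step (D m)) 1# ⟩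
    ⟨ U 0 , pow b (pow (suc m) one) ⟩ + 1# * ⟨ U 0 , pow b (step (D m)) ⟩
      ≈⟨ +-cong (reflexive (≡.cong ⟨ U 0 ,_⟩ (pow-+ b (suc m) one)))
           (trans (*-identityˡ _) (reflexive (≡.cong ⟨ U 0 ,_⟩ (pow-step b (D m))))) ⟩
    Q 0 (b ℕ.+ suc m) + L 0 (suc b) m ∎

-- Proper colourings

star : ∀ {N n} → (ℕ → Bool) → Fin N → Vec (Fin N) n → Bool
star f x []      = true
star f x (y ∷ κ) = (not (f 0) ∨ not (toℕ x ≡ᵇ toℕ y)) ∧ star (f ∘ suc) x κ

-- Each edge is tested once, at its smaller end, and the remaining vertices carry a relabelled edge
-- relation. This lets the graph be dismantled vertex by vertex.
properRec : ∀ {N n} → (ℕ → ℕ → Bool) → Vec (Fin N) n → Bool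
properRec E []      = true
properRec E (x ∷ κ) = star (λ j → E 0 (suc j)) x κ ∧ properRec (λ i j → E (suc i) (suc j)) κ

star-cong : ∀ {N n f g} → (∀ j → f j ≡ g j) → (x : Fin N) (κ : Vec (Fin N) n) → star f x κ ≡ star g x κ
star-cong eq x []      = ≡.refl
star-cong eq x (y ∷ κ) = cong₂ _∧_ (cong (λ b → not b ∨ not (toℕ x ≡ᵇ toℕ y)) (eq 0)) (star-cong (eq ∘ suc) x κ)

star-∨ : ∀ {N n} f g (x : Fin N) (κ : Vec (Fin N) n) → star (λ j → f j ∨ g j) x κ ≡ star f x κ ∧ star g x κ
star-∨ f g x []      = ≡.refl
star-∨ f g x (y ∷ κ) = ≡.trans (cong₂ _∧_ (distrib (f 0) (g 0)) (star-∨ (f ∘ suc) (g ∘ suc) x κ)) (interchange (f₀ (f 0)) (f₀ (g 0)) (star (f ∘ suc) x κ) (star (g ∘ suc) x κ))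
  where
  open import Algebra.Properties.CommutativeSemigroup (CommutativeMonoid.commutativeSemigroup ∧-commutativeMonoid) using (interchange)
  f₀ : Bool → Bool
  f₀ b = not b ∨ not (toℕ x ≡ᵇ toℕ y)
  distrib : ∀ a b {d} → not (a ∨ b) ∨ d ≡ (not a ∨ d) ∧ (not b ∨ d)
  distrib true  true  {true}  = ≡.refl
  distrib true  true  {false} = ≡.refl
  distrib true  false {true}  = ≡.refl
  distrib true  false {false} = ≡.refl
  distrib false b             = ≡.refl

properRec-cong : ∀ {N n E F} → (∀ i j → i ℕ.< j → E i j ≡ F i j) → (κ : Vec (Fin N) n) → properRec E κ ≡ properRec F κ
properRec-cong eq []      = ≡.refl
properRec-cong eq (x ∷ κ) =
  cong₂ _∧_ (star-cong (λ j → eq 0 (suc j) (s≤s z≤n)) x κ) (properRec-cong (λ i j i<j → eq (suc i) (suc j) (s≤s i<j)) κ)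

allF : ∀ {n} → (Fin n → Bool) → Bool
allF {zero}  f = true
allF {suc n} f = f zero ∧ allF (f ∘ suc)

allᵇ-allFin : ∀ n (f : Fin n → Bool) → allᵇ f (allFin n) ≡ allF f
allᵇ-allFin n f = go n f id
  where
  go : ∀ {A : Set} n (f : A → Bool) (g : Fin n → A) → allᵇ f (tabulate g) ≡ allF (f ∘ g)
  go zero    f g = ≡.refl
  go (suc n) f g = cong (f (g zero) ∧_) (go n f (g ∘ suc))

allF-cong : ∀ {n} {f g : Fin n → Bool} → (∀ u → f u ≡ g u) → allF f ≡ allF g
allF-cong {zero}  eq = ≡.refl
allF-cong {suc n} eq = cong₂ _∧_ (eq zero) (allF-cong (eq ∘ suc))

allF-∧ : ∀ {n} (f g : Fin n → Bool) → allF (λ u → f u ∧ g u) ≡ allF f ∧ allF g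
allF-∧ {zero}  f g = ≡.refl
allF-∧ {suc n} f g = ≡.trans (cong ((f zero ∧ g zero) ∧_) (allF-∧ (f ∘ suc) (g ∘ suc))) (interchange (f zero) (g zero) (allF (f ∘ suc)) (allF (g ∘ suc)))
  where open import Algebra.Properties.CommutativeSemigroup (CommutativeMonoid.commutativeSemigroup ∧-commutativeMonoid) using (interchange)

star-allF : ∀ {N n} f (x : Fin N) (κ : Vec (Fin N) n) → star f x κ ≡ allF (λ v → not (f (toℕ v)) ∨ not (toℕ x ≡ᵇ toℕ (lookup κ v)))
star-allF f x []      = ≡.refl
star-allF f x (y ∷ κ) = cong (_ ∧_) (star-allF (f ∘ suc) x κ)

adj : (ℕ → ℕ → Bool) → ℕ → ℕ → Bool
adj E i j = ((i <ᵇ j) ∧ E i j) ∨ ((j <ᵇ i) ∧ E j i)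

≡ᵇ-sym : ∀ i j → (i ≡ᵇ j) ≡ (j ≡ᵇ i)
≡ᵇ-sym zero    zero    = ≡.refl
≡ᵇ-sym zero    (suc j) = ≡.refl
≡ᵇ-sym (suc i) zero    = ≡.refl
≡ᵇ-sym (suc i) (suc j) = ≡ᵇ-sym i j

-- Testing all ordered pairs meets each edge twice: the first row and the first column reduce to the
-- same `star`, and idempotence of ∧ merges them.
properAll≡properRec : ∀ {N n} E (κ : Vec (Fin N) n) →
  allF (λ u → allF (λ v → not (adj E (toℕ u) (toℕ v)) ∨ not (toℕ (lookup κ u) ≡ᵇ toℕ (lookup κ v)))) ≡ properRec E κ
properAll≡properRec E []      = ≡.refl
properAll≡properRec E (x ∷ κ) = begin
  allF row ∧ allF (λ u → col u ∧ inner u)              ≡⟨ cong₂ _∧_ row≡ (allF-∧ col inner) ⟩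
  S ∧ (allF col ∧ allF inner)                          ≡⟨ cong (S ∧_) (cong₂ _∧_ col≡ (properAll≡properRec (λ i j → E (suc i) (suc j)) κ)) ⟩
  S ∧ (S ∧ P)                                          ≡⟨ ∧-assoc S S P ⟨
  (S ∧ S) ∧ P                                          ≡⟨ cong (_∧ P) (∧-idem S) ⟩
  S ∧ P                                                ∎
  where
  open ≡-Reasoning
  S P : Bool
  S = star (λ j → E 0 (suc j)) x κ
  P = properRec (λ i j → E (suc i) (suc j)) κ
  row col inner : Fin _ → Bool
  row v = not (E 0 (suc (toℕ v)) ∨ false) ∨ not (toℕ x ≡ᵇ toℕ (lookup κ v))
  col u = not (E 0 (suc (toℕ u))) ∨ not (toℕ (lookup κ u) ≡ᵇ toℕ x)
  inner u = allF (λ v → not (adj (λ i j → E (suc i) (suc j)) (toℕ u) (toℕ v)) ∨ not (toℕ (lookup κ u) ≡ᵇ toℕ (lookup κ v)))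
  row≡ : allF row ≡ S
  row≡ = ≡.trans (allF-cong (λ v → cong (λ b → not b ∨ not (toℕ x ≡ᵇ toℕ (lookup κ v))) (∨-identityʳ (E 0 (suc (toℕ v)))))) (≡.sym (star-allF _ x κ))
  col≡ : allF col ≡ S
  col≡ = ≡.trans (allF-cong (λ u → cong (λ b → not (E 0 (suc (toℕ u))) ∨ not b) (≡ᵇ-sym (toℕ (lookup κ u)) (toℕ x)))) (≡.sym (star-allF _ x κ))

properᵇ≡properRec : ∀ {N} a b c (κ : Vec (Fin N) (nVert a b c)) → properᵇ a b c κ ≡ properRec (edgeᵇ a b c) κ
properᵇ≡properRec a b c κ = ≡.trans (allᵇ-allFin (nVert a b c) _)
  (≡.trans (allF-cong (λ u → allᵇ-allFin (nVert a b c) (λ v → not (adjᵇ a b c u v) ∨ not (toℕ (lookup κ u) ≡ᵇ toℕ (lookup κ v)))))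
    (properAll≡properRec (edgeᵇ a b c) κ))

does-≟ : ∀ {N} (x y : Fin N) → does (y ≟ x) ≡ (toℕ x ≡ᵇ toℕ y)
does-≟ zero    zero    = ≡.refl
does-≟ zero    (suc y) = ≡.refl
does-≟ (suc x) zero    = ≡.refl
does-≟ (suc x) (suc y) = does-≟ x y

module Colorings {c ℓ} (R : CommutativeRing c ℓ) {N : ℕ} (X : Fin N → CommutativeRing.Carrier R) where

  open CommutativeRing R hiding (zero)
  open Scalars R
  open Elementary R
  open Transfer R X
  open SetoidReasoning setoid
  open import Algebra.Properties.Semiring.Sum semiring using (sum; sum-cong-≋; ∑-comm; *-distribˡ-sum)
  open import Algebra.Solver.Ring.NaturalCoefficients.Default commutativeSemiring

  -- The total weight of the maps satisfying φ, where the first m vertices are weighted by v and the others by X.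
  colSum : Fun → ℕ → (n : ℕ) → (Vec (Fin N) n → Bool) → Carrier
  colSum v m       zero    φ = if φ [] then 1# else 0#
  colSum v zero    (suc n) φ = ⟨ X , (λ x → colSum v zero n (λ κ → φ (x ∷ κ))) ⟩
  colSum v (suc m) (suc n) φ = ⟨ v , (λ x → colSum v m n (λ κ → φ (x ∷ κ))) ⟩

  colSum-cong : ∀ v m n {φ ψ : Vec (Fin N) n → Bool} → (∀ κ → φ κ ≡ ψ κ) → colSum v m n φ ≈ colSum v m n ψ
  colSum-cong v m       zero    eq = reflexive (cong (if_then 1# else 0#) (eq []))
  colSum-cong v zero    (suc n) eq = ⟨⟩-congʳ X (λ x → colSum-cong v zero n (λ κ → eq (x ∷ κ)))
  colSum-cong v (suc m) (suc n) eq = ⟨⟩-congʳ v (λ x → colSum-cong v m n (λ κ → eq (x ∷ κ)))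

  ⟨⟩-zero : ∀ (v : Fun) {h : Fun} → (∀ y → h y ≈ 0#) → ⟨ v , h ⟩ ≈ 0#
  ⟨⟩-zero v eq = trans (⟨⟩-congʳ v (λ y → trans (eq y) (sym (zeroˡ 0#)))) (trans (⟨⟩-scale v (λ _ → 0#) 0#) (zeroˡ _))

  colSum-false : ∀ v m n → colSum v m n (λ _ → false) ≈ 0#
  colSum-false v m       zero    = refl
  colSum-false v zero    (suc n) = ⟨⟩-zero X (λ x → colSum-false v zero n)
  colSum-false v (suc m) (suc n) = ⟨⟩-zero v (λ x → colSum-false v m n)

  -- All vertices get the weight X on either side, so m can be chosen to suit the next use of
  -- `colSum-star`.
  colSum-uniform : ∀ v m n φ → colSum v 0 n φ ≈ colSum X m n φ
  colSum-uniform v m       zero    φ = refl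
  colSum-uniform v zero    (suc n) φ = ⟨⟩-congʳ X (λ x → colSum-uniform v zero n _)
  colSum-uniform v (suc m) (suc n) φ = ⟨⟩-congʳ X (λ x → colSum-uniform v m n _)

  -- Forbidding a colour on the first m vertices is the same as giving it weight 0 there. This is
  -- how adjacency turns into `omit`.
  colSum-star : ∀ v x m n φ → colSum v m n (λ κ → star (_<ᵇ m) x κ ∧ φ κ) ≈ colSum (omit x v) m n φ
  colSum-star v x m       zero    φ = refl
  colSum-star v x zero    (suc n) φ = ⟨⟩-congʳ X (λ y → colSum-star v x zero n _)
  colSum-star v x (suc m) (suc n) φ = sum-cong-≋ go
    where
    go : ∀ y → v y * colSum v m n (λ κ → (not (toℕ x ≡ᵇ toℕ y) ∧ star (_<ᵇ m) x κ) ∧ φ (y ∷ κ))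
             ≈ omit x v y * colSum (omit x v) m n (λ κ → φ (y ∷ κ))
    go y rewrite does-≟ x y with toℕ x ≡ᵇ toℕ y
    ... | true  = trans (*-congˡ (colSum-false v m n)) (trans (zeroʳ _) (sym (zeroˡ _)))
    ... | false = *-congˡ (colSum-star v x m n _)

  pathEdge : ℕ → ℕ → Bool
  pathEdge i j = j ≡ᵇ suc i

  ≡ᵇ0 : ∀ j → (j ≡ᵇ 0) ≡ (j <ᵇ 1)
  ≡ᵇ0 zero    = ≡.refl
  ≡ᵇ0 (suc j) = ≡.refl

  -- The extra condition makes the last of the m+1 path vertices avoid x. With v = `omit x X` the
  -- path closes up to a cycle through a vertex coloured x, and the right side becomes
  -- `D (suc m) x`.
  colSum-closedPath : ∀ m v x →
    colSum v 1 (suc m) (λ κ → star (_≡ᵇ m) x κ ∧ properRec pathEdge κ) ≈ ⟨ v , pow m (omit x one) ⟩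
  colSum-closedPath zero    v x = ⟨⟩-congʳ v go
    where
    go : ∀ y → (if (not (toℕ x ≡ᵇ toℕ y) ∧ true) ∧ true then 1# else 0#) ≈ omit x one y
    go y rewrite does-≟ x y with toℕ x ≡ᵇ toℕ y
    ... | true  = refl
    ... | false = refl
  colSum-closedPath (suc m) v x = ⟨⟩-congʳ v (λ y → begin
    colSum v 0 (suc m) (λ κ → S κ ∧ (star (_≡ᵇ 0) y κ ∧ properRec pathEdge κ))
      ≈⟨ colSum-uniform v 1 (suc m) (λ κ → S κ ∧ (star (_≡ᵇ 0) y κ ∧ properRec pathEdge κ)) ⟩
    colSum X 1 (suc m) (λ κ → S κ ∧ (star (_≡ᵇ 0) y κ ∧ properRec pathEdge κ))
      ≈⟨ colSum-cong X 1 (suc m) (λ κ → ≡.trans (x∙yz≈y∙xz (S κ) (star (_≡ᵇ 0) y κ) _) (cong (_∧ (S κ ∧ properRec pathEdge κ)) (star-cong ≡ᵇ0 y κ))) ⟩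
    colSum X 1 (suc m) (λ κ → star (_<ᵇ 1) y κ ∧ (S κ ∧ properRec pathEdge κ))
      ≈⟨ colSum-star X y 1 (suc m) (λ κ → S κ ∧ properRec pathEdge κ) ⟩
    colSum (omit y X) 1 (suc m) (λ κ → S κ ∧ properRec pathEdge κ)
      ≈⟨ colSum-closedPath m (omit y X) x ⟩
    pow (suc m) (omit x one) y ∎)
    where
    open import Algebra.Properties.CommutativeSemigroup (CommutativeMonoid.commutativeSemigroup ∧-commutativeMonoid) using (x∙yz≈y∙xz)
    S : ∀ {n} → Vec (Fin N) n → Bool
    S = star (_≡ᵇ m) x

  -- Vertices are removed from the free end of the tail. At b = 0 the first vertex is the base of
  -- the cycle: `_≡ᵇ 0` is the edge to its successor and `_≡ᵇ m` the closing edge, which coincide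
  -- for m = 0.
  colSum-tadpole : ∀ b m v → colSum v 1 (b ℕ.+ suc (suc m)) (properRec (edgeᵇ 1 b (suc (suc m)))) ≈ ⟨ v , pow b (D (suc m)) ⟩
  colSum-tadpole zero m v = ⟨⟩-congʳ v (λ x → begin
    colSum v 0 (suc m) (λ κ → star (λ j → (j ≡ᵇ 0) ∨ (j ≡ᵇ m)) x κ ∧ properRec (λ i j → (j ≡ᵇ suc i) ∨ false) κ)
      ≈⟨ colSum-uniform v 1 (suc m) (λ κ → star (λ j → (j ≡ᵇ 0) ∨ (j ≡ᵇ m)) x κ ∧ properRec (λ i j → (j ≡ᵇ suc i) ∨ false) κ) ⟩
    colSum X 1 (suc m) (λ κ → star (λ j → (j ≡ᵇ 0) ∨ (j ≡ᵇ m)) x κ ∧ properRec (λ i j → (j ≡ᵇ suc i) ∨ false) κ)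
      ≈⟨ colSum-cong X 1 (suc m) (λ κ → ≡.trans
           (cong₂ _∧_ (≡.trans (star-∨ (_≡ᵇ 0) (_≡ᵇ m) x κ) (cong (_∧ star (_≡ᵇ m) x κ) (star-cong ≡ᵇ0 x κ)))
             (properRec-cong (λ i j _ → ∨-identityʳ (j ≡ᵇ suc i)) κ))
           (∧-assoc (star (_<ᵇ 1) x κ) (star (_≡ᵇ m) x κ) (properRec pathEdge κ))) ⟩
    colSum X 1 (suc m) (λ κ → star (_<ᵇ 1) x κ ∧ (star (_≡ᵇ m) x κ ∧ properRec pathEdge κ))
      ≈⟨ colSum-star X x 1 (suc m) (λ κ → star (_≡ᵇ m) x κ ∧ properRec pathEdge κ) ⟩
    colSum (omit x X) 1 (suc m) (λ κ → star (_≡ᵇ m) x κ ∧ properRec pathEdge κ)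
      ≈⟨ colSum-closedPath m (omit x X) x ⟩
    D (suc m) x ∎)
  colSum-tadpole (suc b) m v = ⟨⟩-congʳ v (λ x → begin
    colSum v 0 len (λ κ → star (λ j → (j ≡ᵇ 0) ∨ false) x κ ∧ properRec (λ i j → edgeᵇ 1 (suc b) (suc (suc m)) (suc i) (suc j)) κ)
      ≈⟨ colSum-uniform v 1 len (λ κ → star (λ j → (j ≡ᵇ 0) ∨ false) x κ ∧ properRec (λ i j → edgeᵇ 1 (suc b) (suc (suc m)) (suc i) (suc j)) κ) ⟩
    colSum X 1 len (λ κ → star (λ j → (j ≡ᵇ 0) ∨ false) x κ ∧ properRec (λ i j → edgeᵇ 1 (suc b) (suc (suc m)) (suc i) (suc j)) κ)
      ≈⟨ colSum-cong X 1 len (λ κ → cong₂ _∧_ (star-cong (λ j → ≡.trans (∨-identityʳ (j ≡ᵇ 0)) (≡ᵇ0 j)) x κ) (properRec-cong edge-shift κ)) ⟩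
    colSum X 1 len (λ κ → star (_<ᵇ 1) x κ ∧ properRec (edgeᵇ 1 b (suc (suc m))) κ)
      ≈⟨ colSum-star X x 1 len (properRec (edgeᵇ 1 b (suc (suc m)))) ⟩
    colSum (omit x X) 1 len (properRec (edgeᵇ 1 b (suc (suc m))))
      ≈⟨ colSum-tadpole b m (omit x X) ⟩
    pow (suc b) (D (suc m)) x ∎)
    where
    len = b ℕ.+ suc (suc m)
    -- The clique test `j <ᵇ 1` of the smaller graph is true exactly at j = 0, which i < j rules
    -- out.
    edge-shift : ∀ i j → i ℕ.< j → edgeᵇ 1 (suc b) (suc (suc m)) (suc i) (suc j) ≡ edgeᵇ 1 b (suc (suc m)) i j
    edge-shift i (suc j) _ rewrite ℕₚ.+-suc b (suc m) = ≡.refl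

  omit-comm : ∀ x y (v : Fun) z → omit x (omit y v) z ≡ omit y (omit x v) z
  omit-comm x y v z with does (z ≟ x) | does (z ≟ y)
  ... | true  | true  = ≡.refl
  ... | true  | false = ≡.refl
  ... | false | true  = ≡.refl
  ... | false | false = ≡.refl

  *-omit : ∀ x y (v : Fun) → v x * omit x v y ≈ v y * omit y v x
  *-omit x y v with y ≟ x | x ≟ y
  ... | yes _   | yes _   = trans (zeroʳ _) (sym (zeroʳ _))
  ... | no _    | no _    = *-comm _ _
  ... | yes y≡x | no x≢y  = contradiction (≡.sym y≡x) x≢y
  ... | no y≢x  | yes x≡y = contradiction (≡.sym x≡y) y≢x

  -- This is `U a` when v = X. The general v records that the colours of clique vertices already
  -- removed have weight 0.
  cliqueVec : ℕ → Fun → Fun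
  cliqueVec a v y = v y * elem a (omit y v)

  -- The left side chooses the colour x of the removed vertex, then the colour y of the last clique
  -- vertex. After the sums are exchanged, the inner sum over x is Euler's identity in the variables
  -- other than the one of y, whence the factor a+1.
  cliqueVec-peel : ∀ a v h → ⟨ v , (λ x → ⟨ cliqueVec a (omit x v) , h ⟩) ⟩ ≈ ι (suc a) * ⟨ cliqueVec (suc a) v , h ⟩
  cliqueVec-peel a v h = begin
    sum (λ x → v x * ⟨ cliqueVec a (omit x v) , h ⟩)
      ≈⟨ sum-cong-≋ (λ x → *-distribˡ-sum (v x) (λ y → cliqueVec a (omit x v) y * h y)) ⟩
    sum (λ x → sum (λ y → v x * (cliqueVec a (omit x v) y * h y)))
      ≈⟨ sum-cong-≋ (λ x → sum-cong-≋ (λ y → swap x y)) ⟩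
    sum (λ x → sum (λ y → (v y * h y) * (omit y v x * elem a (omit x (omit y v)))))
      ≈⟨ ∑-comm (λ x y → (v y * h y) * (omit y v x * elem a (omit x (omit y v)))) ⟩
    sum (λ y → sum (λ x → (v y * h y) * (omit y v x * elem a (omit x (omit y v)))))
      ≈⟨ sum-cong-≋ (λ y → *-distribˡ-sum (v y * h y) (λ x → omit y v x * elem a (omit x (omit y v)))) ⟨
    sum (λ y → (v y * h y) * ⟨ omit y v , (λ x → elem a (omit x (omit y v))) ⟩)
      ≈⟨ sum-cong-≋ (λ y → trans (*-congˡ (elem-euler a (omit y v)))
           (solve 4 (λ p q i r → (p :* q) :* ((con 1 :+ i) :* r) := (con 1 :+ i) :* ((p :* r) :* q)) refl (v y) (h y) (ι a) (elem (suc a) (omit y v)))) ⟩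
    sum (λ y → ι (suc a) * (cliqueVec (suc a) v y * h y))
      ≈⟨ *-distribˡ-sum (ι (suc a)) (λ y → cliqueVec (suc a) v y * h y) ⟨
    ι (suc a) * ⟨ cliqueVec (suc a) v , h ⟩ ∎
    where
    swap : ∀ x y → v x * (cliqueVec a (omit x v) y * h y) ≈ (v y * h y) * (omit y v x * elem a (omit x (omit y v)))
    swap x y = begin
      v x * ((omit x v y * elem a (omit y (omit x v))) * h y)
        ≈⟨ solve 4 (λ p q r s → p :* ((q :* r) :* s) := (p :* q) :* (r :* s)) refl (v x) (omit x v y) (elem a (omit y (omit x v))) (h y) ⟩
      (v x * omit x v y) * (elem a (omit y (omit x v)) * h y)
        ≈⟨ *-cong (*-omit x y v) (*-congʳ (elem-cong a (λ z → reflexive (omit-comm y x v z)))) ⟩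
      (v y * omit y v x) * (elem a (omit x (omit y v)) * h y)
        ≈⟨ solve 4 (λ p q r s → (p :* q) :* (r :* s) := (p :* s) :* (q :* r)) refl (v y) (omit y v x) (elem a (omit x (omit y v))) (h y) ⟩
      (v y * h y) * (omit y v x * elem a (omit x (omit y v))) ∎

  -- The weight v covers the clique together with its last vertex, where the tail starts. Removing
  -- the first clique vertex deletes its colour from v, and the factors of `cliqueVec-peel` multiply
  -- up to the factorial.
  colSum-graph : ∀ a b m v →
    colSum v (suc a) (a ℕ.+ b ℕ.+ suc (suc m)) (properRec (edgeᵇ (suc a) b (suc (suc m))))
      ≈ ι (a !) * ⟨ cliqueVec a v , pow b (D (suc m)) ⟩
  colSum-graph zero    b m v = begin
    colSum v 1 (b ℕ.+ suc (suc m)) (properRec (edgeᵇ 1 b (suc (suc m))))  ≈⟨ colSum-tadpole b m v ⟩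
    ⟨ v , H ⟩                                          ≈⟨ ⟨⟩-congˡ H (λ y → sym (*-identityʳ (v y))) ⟩
    ⟨ cliqueVec 0 v , H ⟩                              ≈⟨ solve 1 (λ x → x := (con 1 :+ con 0) :* x) refl _ ⟩
    ι 1 * ⟨ cliqueVec 0 v , H ⟩                        ∎
    where H = pow b (D (suc m))
  colSum-graph (suc a) b m v = begin
    ⟨ v , (λ x → colSum v (suc a) len (λ κ → star (λ j → (j <ᵇ suc a) ∨ false) x κ ∧ properRec (λ i j → edgeᵇ (suc (suc a)) b (suc (suc m)) (suc i) (suc j)) κ)) ⟩
      ≈⟨ ⟨⟩-congʳ v (λ x → colSum-cong v (suc a) len (λ κ →
           cong₂ _∧_ (star-cong (λ j → ∨-identityʳ (j <ᵇ suc a)) x κ) (properRec-cong (λ i j _ → edge-shift a i j) κ))) ⟩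
    ⟨ v , (λ x → colSum v (suc a) len (λ κ → star (_<ᵇ suc a) x κ ∧ properRec (edgeᵇ (suc a) b (suc (suc m))) κ)) ⟩
      ≈⟨ ⟨⟩-congʳ v (λ x → trans (colSum-star v x (suc a) len (properRec (edgeᵇ (suc a) b (suc (suc m))))) (colSum-graph a b m (omit x v))) ⟩
    ⟨ v , (λ x → ι (a !) * ⟨ cliqueVec a (omit x v) , H ⟩) ⟩
      ≈⟨ trans (⟨⟩-scale v _ (ι (a !))) (*-congˡ (cliqueVec-peel a v H)) ⟩
    ι (a !) * (ι (suc a) * ⟨ cliqueVec (suc a) v , H ⟩)
      ≈⟨ solve 3 (λ p q r → p :* (q :* r) := (q :* p) :* r) refl (ι (a !)) (ι (suc a)) _ ⟩
    (ι (suc a) * ι (a !)) * ⟨ cliqueVec (suc a) v , H ⟩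
      ≈⟨ *-congʳ (ι-* (suc a) (a !)) ⟨
    ι (suc a !) * ⟨ cliqueVec (suc a) v , H ⟩ ∎
    where
    len = a ℕ.+ b ℕ.+ suc (suc m)
    H = pow b (D (suc m))
    edge-shift : ∀ a i j → edgeᵇ (suc (suc a)) b (suc (suc m)) (suc i) (suc j) ≡ edgeᵇ (suc a) b (suc (suc m)) i j
    edge-shift zero    i j rewrite ℕₚ.+-suc b (suc m) = ≡.refl
    edge-shift (suc a) i j rewrite ℕₚ.+-suc (a ℕ.+ b) (suc m) = ≡.refl

-- Sums over compositions

data IsComp : ℕ → List ℕ → Set where
  []  : IsComp 0 []
  _∷_ : ∀ i {r K} → IsComp r K → IsComp (suc i ℕ.+ r) (suc i ∷ K)

comps-IsComp : ∀ n → All (IsComp n) (comps n)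
comps-IsComp zero    = [] ∷ []
comps-IsComp (suc n) = Allₚ.++⁺ (Allₚ.map⁺ (All.map (0 ∷_) (comps-IsComp n))) (incr (comps-IsComp n))
  where
  incr : ∀ {n Ks} → All (IsComp n) Ks → All (IsComp (suc n)) (incrFirst Ks)
  incr []              = []
  incr ([] ∷ cs)       = incr cs
  incr ((i ∷ c) ∷ cs)  = (suc i ∷ c) ∷ incr cs

_≟ᴸ_ : (K J : List ℕ) → Dec (K ≡ J)
_≟ᴸ_ = ≡-dec ℕₚ._≟_

swapHead : List ℕ → List ℕ
swapHead (j ∷ k ∷ K) = k ∷ j ∷ K
swapHead K           = K

insertSecond : ℕ → List ℕ → List ℕ
insertSecond k []      = k ∷ []
insertSecond k (j ∷ J) = j ∷ k ∷ J

swapHead-insertSecond : ∀ k K → swapHead (insertSecond k K) ≡ k ∷ K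
swapHead-insertSecond k []      = ≡.refl
swapHead-insertSecond k (j ∷ J) = ≡.refl

module CompositionSum {c ℓ} (M : CommutativeMonoid c ℓ) where

  open CommutativeMonoid M
  open Antidiagonal M
  open ListSum M
  open SetoidReasoning setoid

  S : ℕ → (List ℕ → Carrier) → Carrier
  S n f = Σ[ f ] (comps n)

  S-cong : ∀ n {f g} → (∀ {K} → IsComp n K → f K ≈ g K) → S n f ≈ S n g
  S-cong n {f} {g} eq = go (comps-IsComp n)
    where
    go : ∀ {Ks} → All (IsComp n) Ks → Σ[ f ] Ks ≈ Σ[ g ] Ks
    go []       = refl
    go (c ∷ cs) = ∙-cong (eq c) (go cs)

  private
    incr : (List ℕ → Carrier) → List ℕ → Carrier
    incr f []      = ε
    incr f (k ∷ K) = f (suc k ∷ K)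

    Σ-incrFirst : ∀ f Ks → Σ[ f ] (incrFirst Ks) ≈ Σ[ incr f ] Ks
    Σ-incrFirst f []             = refl
    Σ-incrFirst f ([] ∷ Ks)      = trans (Σ-incrFirst f Ks) (sym (identityˡ _))
    Σ-incrFirst f ((k ∷ K) ∷ Ks) = ∙-congˡ (Σ-incrFirst f Ks)

    S-incr : ∀ n f → S (suc n) f ≈ S n (λ K → f (1 ∷ K)) ∙ S n (incr f)
    S-incr n f = trans (Σ-++ f (map (1 ∷_) (comps n)) (incrFirst (comps n)))
      (∙-cong (reflexive (Σ-map f (1 ∷_) (comps n))) (Σ-incrFirst f (comps n)))

  -- Every first part i+1 arises from 1 by i increments, so the recursion of `comps` unrolls into a
  -- sum over first parts.
  S-suc : ∀ n f → S (suc n) f ≈ anti n (λ i r → S r (λ K → f (suc i ∷ K)))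
  S-suc zero    f = refl
  S-suc (suc n) f = trans (S-incr (suc n) f) (∙-congˡ (S-suc n (incr f)))

  S-first : ∀ n f → S (suc (suc n)) f ≈ anti n (λ i r → S (suc r) (λ K → f (suc i ∷ K))) ∙ f (suc (suc n) ∷ [])
  S-first n f = trans (S-suc (suc n) f) (trans (anti-splitLast n (λ i r → S r (λ K → f (suc i ∷ K)))) (∙-congˡ (identityʳ _)))

  -- In the triple sum over first part, second part and remainder the outer two indices are
  -- exchanged; the first part is then folded back into the inner composition.
  S-second : ∀ n f → S (suc (suc n)) f ≈ anti n (λ i r → S (suc r) (λ K → f (insertSecond (suc i) K))) ∙ f (suc (suc n) ∷ [])
  S-second n f = begin
    S (suc (suc n)) f
      ≈⟨ S-first n f ⟩
    anti n (λ i r → S (suc r) (λ K → f (suc i ∷ K))) ∙ f₁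
      ≈⟨ ∙-congʳ (anti-cong n (λ i r _ → S-suc r (λ K → f (suc i ∷ K)))) ⟩
    anti n (λ i r → anti r (λ j s → S s (λ K → f (suc i ∷ suc j ∷ K)))) ∙ f₁
      ≈⟨ ∙-congʳ (anti-swap n (λ i j s → S s (λ K → f (suc i ∷ suc j ∷ K)))) ⟩
    anti n (λ i r → anti r (λ j s → S s (λ K → f (suc j ∷ suc i ∷ K)))) ∙ f₁
      ≈⟨ ∙-congʳ (anti-cong n (λ i r _ → S-suc r (λ K → f (insertSecond (suc i) K)))) ⟨
    anti n (λ i r → S (suc r) (λ K → f (insertSecond (suc i) K))) ∙ f₁ ∎
    where f₁ = f (suc (suc n) ∷ [])

  S-swapHead : ∀ n f → S n f ≈ S n (f ∘ swapHead)
  S-swapHead zero          f = refl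
  S-swapHead (suc zero)    f = refl
  S-swapHead (suc (suc n)) f = begin
    S (suc (suc n)) f
      ≈⟨ S-first n f ⟩
    anti n (λ i r → S (suc r) (λ K → f (suc i ∷ K))) ∙ f₁
      ≈⟨ ∙-congʳ (anti-cong n (λ i r _ → Σ-cong (λ K → reflexive (cong f (swapHead-insertSecond (suc i) K))) (comps (suc r)))) ⟨
    anti n (λ i r → S (suc r) (λ K → f (swapHead (insertSecond (suc i) K)))) ∙ f₁
      ≈⟨ S-second n (f ∘ swapHead) ⟨
    S (suc (suc n)) (f ∘ swapHead) ∎
    where f₁ = f (suc (suc n) ∷ [])

  -- This expresses that `comps` lists every composition exactly once.
  S-pick : ∀ {n J} → IsComp n J → ∀ g → S n (λ K → if does (K ≟ᴸ J) then g K else ε) ≈ g J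
  S-pick []                    g = identityʳ _
  S-pick (_∷_ i {r} {J} c) g = begin
    S (suc i ℕ.+ r) F                                 ≈⟨ S-suc (i ℕ.+ r) F ⟩
    anti (i ℕ.+ r) (λ j s → S s (λ K → F (suc j ∷ K))) ≈⟨ anti-pick i r _ (λ j s j≢i → Σ-ε (off j j≢i) (comps s)) ⟩
    S r (λ K → F (suc i ∷ K))                         ≈⟨ Σ-cong on (comps r) ⟩
    S r (λ K → if does (K ≟ᴸ J) then g (suc i ∷ K) else ε) ≈⟨ S-pick c (λ K → g (suc i ∷ K)) ⟩
    g (suc i ∷ J)                                     ∎
    where
    F : List ℕ → Carrier
    F K = if does (K ≟ᴸ (suc i ∷ J)) then g K else ε
    off : ∀ j → j ≢ i → ∀ K → F (suc j ∷ K) ≈ ε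
    off j j≢i K with j ≡ᵇ i in eq
    ... | true  = contradiction (ℕₚ.≡ᵇ⇒≡ j i (≡.subst T (≡.sym eq) _)) j≢i
    ... | false = refl
    on : ∀ K → F (suc i ∷ K) ≈ (if does (K ≟ᴸ J) then g (suc i ∷ K) else ε)
    on K with i ≡ᵇ i | ℕₚ.≡⇒≡ᵇ i i ≡.refl
    ... | true | _ = refl

-- Partial sums of a composition and the function Θ

ΘK-big : ∀ k K t → suc t ℕ.≤ k → ΘK (k ∷ K) (suc t) ≡ k ∸ suc t
ΘK-big k K t t<k rewrite ℕₚ.m≤n⇒m∸n≡0 t<k = cong (_∸ suc t) (ℕₚ.+-identityʳ k)

ΘK-small : ∀ k K t → k ℕ.≤ t → ΘK (k ∷ K) t ≡ ΘK K (t ∸ k)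
ΘK-small zero K zero    z≤n = ≡.refl
ΘK-small k    K (suc t) k≤t = begin
  (k ℕ.+ σK K (suc t ∸ k)) ∸ suc t                ≡⟨ cong ((k ℕ.+ σK K (suc t ∸ k)) ∸_) (ℕₚ.m+[n∸m]≡n k≤t) ⟨
  (k ℕ.+ σK K (suc t ∸ k)) ∸ (k ℕ.+ (suc t ∸ k))  ≡⟨ ℕₚ.[m+n]∸[m+o]≡n∸o k _ _ ⟩
  σK K (suc t ∸ k) ∸ (suc t ∸ k)                  ∎
  where open ≡-Reasoning

-- The part of K starting at the partial sum t, or 0 if t is not a partial sum.
nextPart : List ℕ → ℕ → ℕ
nextPart []      t       = 0
nextPart (k ∷ K) zero    = k
nextPart (k ∷ K) (suc t) = if k ≤ᵇ suc t then nextPart K (suc t ∸ k) else 0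

≤ᵇ-true : ∀ {m n} → m ℕ.≤ n → (m ≤ᵇ n) ≡ true
≤ᵇ-true {m} {n} m≤n with m ≤ᵇ n | ℕₚ.≤⇒≤ᵇ m≤n
... | true | _ = ≡.refl

≤ᵇ-false : ∀ {m n} → n ℕ.< m → (m ≤ᵇ n) ≡ false
≤ᵇ-false {m} {n} n<m with m ≤ᵇ n in eq
... | false = ≡.refl
... | true  = contradiction (ℕₚ.≤ᵇ⇒≤ m n (≡.subst T (≡.sym eq) _)) (ℕₚ.<⇒≱ n<m)

nextPart-small : ∀ k K t → k ℕ.≤ suc t → nextPart (k ∷ K) (suc t) ≡ nextPart K (suc t ∸ k)
nextPart-small k K t k≤t rewrite ≤ᵇ-true k≤t = ≡.refl

nextPart-big : ∀ k K t → suc t ℕ.< k → nextPart (k ∷ K) (suc t) ≡ 0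
nextPart-big k K t t<k rewrite ≤ᵇ-false t<k = ≡.refl

-- If t is not a partial sum, σ is the same at t and t+1, so Θ drops by 1. At a partial sum Θ is 0
-- and σ jumps by the next part; t < n guarantees that there is one.
ΘK-suc : ∀ {n K} → IsComp n K → ∀ t → t ℕ.< n → ΘK K t ℕ.+ nextPart K t ≡ suc (ΘK K (suc t))
ΘK-suc (_∷_ i {K = K} c) zero    _   = cong suc (≡.sym (ΘK-big (suc i) K 0 (s≤s z≤n)))
ΘK-suc (_∷_ i {r} {K} c) (suc t) t<n with suc i ≤? suc t
... | yes i≤t = begin
  ΘK (suc i ∷ K) (suc t) ℕ.+ nextPart (suc i ∷ K) (suc t)
    ≡⟨ cong₂ ℕ._+_ (ΘK-small (suc i) K (suc t) i≤t) (nextPart-small (suc i) K t i≤t) ⟩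
  ΘK K (t ∸ i) ℕ.+ nextPart K (t ∸ i)
    ≡⟨ ΘK-suc c (t ∸ i) (≡.subst (t ∸ i ℕ.<_) (ℕₚ.m+n∸m≡n i r) (ℕₚ.∸-monoˡ-< (ℕₚ.≤-pred t<n) (ℕₚ.≤-pred i≤t))) ⟩
  suc (ΘK K (suc (t ∸ i)))
    ≡⟨ cong (λ u → suc (ΘK K u)) (ℕₚ.+-∸-assoc 1 (ℕₚ.≤-pred i≤t)) ⟨
  suc (ΘK K (suc t ∸ i))
    ≡⟨ cong suc (ΘK-small (suc i) K (suc (suc t)) (ℕₚ.m≤n⇒m≤1+n i≤t)) ⟨
  suc (ΘK (suc i ∷ K) (suc (suc t))) ∎
  where open ≡-Reasoning
... | no i≰t = begin
  ΘK (suc i ∷ K) (suc t) ℕ.+ nextPart (suc i ∷ K) (suc t)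
    ≡⟨ cong₂ ℕ._+_ (ΘK-big (suc i) K t (ℕₚ.<⇒≤ t<i)) (nextPart-big (suc i) K t t<i) ⟩
  (i ∸ t) ℕ.+ 0
    ≡⟨ ℕₚ.+-identityʳ _ ⟩
  i ∸ t
    ≡⟨ ℕₚ.+-∸-assoc 1 {i} (ℕₚ.≤-pred t<i) ⟩
  suc (i ∸ suc t)
    ≡⟨ cong suc (ΘK-big (suc i) K (suc t) t<i) ⟨
  suc (ΘK (suc i ∷ K) (suc (suc t))) ∎
  where
  open ≡-Reasoning
  t<i : suc t ℕ.< suc i
  t<i = ℕₚ.≰⇒> i≰t

ΘK-full : ∀ {n K} → IsComp n K → ΘK K n ≡ 0
ΘK-full []                = ≡.refl
ΘK-full (_∷_ i {r} {K} c) = ≡.trans (ΘK-small (suc i) K (suc i ℕ.+ r) (ℕₚ.m≤m+n (suc i) r))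
  (≡.trans (cong (ΘK K) (ℕₚ.m+n∸m≡n (suc i) r)) (ΘK-full c))

-- Every partial sum of `j ∷ J` from j on reappears raised by k+1, just like the threshold, and j
-- itself is a further partial sum. The latter matters only if it reaches the raised threshold: then
-- Θ is smaller by k+1, which the first summand restores.
ΘK-insertSecond : ∀ j k J s → (if (suc k ℕ.+ suc s) ≤ᵇ j then suc k else 0) ℕ.+ ΘK (j ∷ suc k ∷ J) (suc k ℕ.+ suc s) ≡ ΘK (j ∷ J) (suc s)
ΘK-insertSecond j k J s with suc k ℕ.+ suc s ≤? j
... | yes t≤j rewrite ≤ᵇ-true t≤j = begin
  suc k ℕ.+ ΘK (j ∷ suc k ∷ J) (suc k ℕ.+ suc s)  ≡⟨ cong (suc k ℕ.+_) (ΘK-big j (suc k ∷ J) (k ℕ.+ suc s) t≤j) ⟩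
  suc k ℕ.+ (j ∸ (suc k ℕ.+ suc s))               ≡⟨ ℕₚ.+-∸-assoc (suc k) t≤j ⟨
  (suc k ℕ.+ j) ∸ (suc k ℕ.+ suc s)               ≡⟨ ℕₚ.[m+n]∸[m+o]≡n∸o (suc k) j (suc s) ⟩
  j ∸ suc s                                       ≡⟨ ΘK-big j J s (ℕₚ.≤-trans (ℕₚ.m≤n+m (suc s) (suc k)) t≤j) ⟨
  ΘK (j ∷ J) (suc s)                              ∎
  where open ≡-Reasoning
... | no t≰j rewrite ≤ᵇ-false (ℕₚ.≰⇒> t≰j) = ≡.trans (ΘK-small j (suc k ∷ J) (suc k ℕ.+ suc s) (ℕₚ.<⇒≤ (ℕₚ.≰⇒> t≰j))) go
  where
  go : ΘK (suc k ∷ J) ((suc k ℕ.+ suc s) ∸ j) ≡ ΘK (j ∷ J) (suc s)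
  go with j ≤? suc s
  ... | yes j≤s = begin
    ΘK (suc k ∷ J) ((suc k ℕ.+ suc s) ∸ j)   ≡⟨ cong (ΘK (suc k ∷ J)) (ℕₚ.+-∸-assoc (suc k) j≤s) ⟩
    ΘK (suc k ∷ J) (suc k ℕ.+ (suc s ∸ j))   ≡⟨ ΘK-small (suc k) J _ (ℕₚ.m≤m+n (suc k) _) ⟩
    ΘK J (suc k ℕ.+ (suc s ∸ j) ∸ suc k)     ≡⟨ cong (ΘK J) (ℕₚ.m+n∸m≡n (suc k) (suc s ∸ j)) ⟩
    ΘK J (suc s ∸ j)                         ≡⟨ ΘK-small j J (suc s) j≤s ⟨
    ΘK (j ∷ J) (suc s)                       ∎
    where open ≡-Reasoning
  -- Now j lies above s+1 and below the raised threshold: j = s+1+u and k+1 = u+v+1, and both sides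
  -- equal u.
  ... | no j≰s with ℕₚ.m≤n⇒∃[o]m+o≡n (ℕₚ.<⇒≤ (ℕₚ.≰⇒> j≰s)) | ℕₚ.m≤n⇒∃[o]m+o≡n (ℕₚ.≰⇒> t≰j)
  ... | u , ≡.refl | v , eq = begin
    ΘK (suc k ∷ J) ((suc k ℕ.+ suc s) ∸ (suc s ℕ.+ u))  ≡⟨ cong (ΘK (suc k ∷ J)) d≡ ⟩
    ΘK (suc k ∷ J) (suc v)                              ≡⟨ ΘK-big (suc k) J v (≡.subst (suc v ℕ.≤_) (≡.sym k≡) (ℕₚ.m≤n+m (suc v) u)) ⟩
    suc k ∸ suc v                                       ≡⟨ cong (_∸ suc v) k≡ ⟩
    (u ℕ.+ suc v) ∸ suc v                               ≡⟨ ℕₚ.m+n∸n≡m u (suc v) ⟩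
    u                                                   ≡⟨ ℕₚ.m+n∸m≡n (suc s) u ⟨
    (suc s ℕ.+ u) ∸ suc s                               ≡⟨ ΘK-big (suc s ℕ.+ u) J s (ℕₚ.m≤m+n (suc s) u) ⟨
    ΘK (suc s ℕ.+ u ∷ J) (suc s)                        ∎
    where
    open ≡-Reasoning
    k≡ : suc k ≡ u ℕ.+ suc v
    k≡ = ℕₚ.+-cancelˡ-≡ (suc s) (suc k) (u ℕ.+ suc v) (begin
      suc s ℕ.+ suc k          ≡⟨ ℕₚ.+-comm (suc s) (suc k) ⟩
      suc k ℕ.+ suc s          ≡⟨ eq ⟨
      suc (suc s ℕ.+ u) ℕ.+ v  ≡⟨ ℕₚ.+-suc (suc s ℕ.+ u) v ⟨
      (suc s ℕ.+ u) ℕ.+ suc v  ≡⟨ ℕₚ.+-assoc (suc s) u (suc v) ⟩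
      suc s ℕ.+ (u ℕ.+ suc v)  ∎)
    d≡ : (suc k ℕ.+ suc s) ∸ (suc s ℕ.+ u) ≡ suc v
    d≡ = begin
      (suc k ℕ.+ suc s) ∸ (suc s ℕ.+ u)            ≡⟨ cong (_∸ (suc s ℕ.+ u)) (ℕₚ.+-comm (suc k) (suc s)) ⟩
      (suc s ℕ.+ suc k) ∸ (suc s ℕ.+ u)            ≡⟨ ℕₚ.[m+n]∸[m+o]≡n∸o (suc s) (suc k) u ⟩
      suc k ∸ u                                    ≡⟨ cong (_∸ u) k≡ ⟩
      (u ℕ.+ suc v) ∸ u                            ≡⟨ ℕₚ.m+n∸m≡n u (suc v) ⟩
      suc v                                        ∎

<ᵇ-true : ∀ {m n} → m ℕ.< n → (m <ᵇ n) ≡ true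
<ᵇ-true {m} {n} m<n with m <ᵇ n | ℕₚ.<⇒<ᵇ m<n
... | true | _ = ≡.refl

<ᵇ-false : ∀ {m n} → n ℕ.≤ m → (m <ᵇ n) ≡ false
<ᵇ-false {m} {n} n≤m with m <ᵇ n in eq
... | false = ≡.refl
... | true  = contradiction (ℕₚ.<ᵇ⇒< m n (≡.subst T (≡.sym eq) _)) (ℕₚ.≤⇒≯ n≤m)

≡ᵇ-false : ∀ {m n} → m ≢ n → (m ≡ᵇ n) ≡ false
≡ᵇ-false {m} {n} m≢n with m ≡ᵇ n in eq
... | false = ≡.refl
... | true  = contradiction (ℕₚ.≡ᵇ⇒≡ m n (≡.subst T (≡.sym eq) _)) m≢n

≡ᵇ-refl : ∀ n → (n ≡ᵇ n) ≡ true
≡ᵇ-refl zero    = ≡.refl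
≡ᵇ-refl (suc n) = ≡ᵇ-refl n

-- For t = a + b the graph with clique K_a has coefficients keepLarge a t - excess a t; raising a to a + 1 at fixed t
-- subtracts secondIs a t.
keepLarge : ℕ → ℕ → List ℕ → ℕ
keepLarge a t (j ∷ k ∷ K) = if k <ᵇ a then 0 else ΘK (j ∷ k ∷ K) t ℕ.* wK (j ∷ k ∷ K)
keepLarge a t K           = ΘK K t ℕ.* wK K

excess : ℕ → ℕ → List ℕ → ℕ
excess a t (j ∷ k ∷ K) = if (k <ᵇ a) ∧ (t ≤ᵇ j) then k ℕ.* wK (j ∷ k ∷ K) else 0
excess a t K           = 0

secondIs : ℕ → ℕ → List ℕ → ℕ
secondIs a t (j ∷ k ∷ K) = if k ≡ᵇ a then ((if t ≤ᵇ j then k else 0) ℕ.+ ΘK (j ∷ k ∷ K) t) ℕ.* wK (j ∷ k ∷ K) else 0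
secondIs a t K           = 0

-- Only the second part k = a changes sides: it leaves `keepLarge` and enters `excess`, and
-- `secondIs` is the sum of these two contributions.
keepLarge-suc : ∀ a t K → keepLarge a t K ℕ.+ excess (suc a) t K ≡ (keepLarge (suc a) t K ℕ.+ excess a t K) ℕ.+ secondIs a t K
keepLarge-suc a t []      = ≡.sym (ℕₚ.+-identityʳ _)
keepLarge-suc a t (j ∷ []) = ≡.sym (ℕₚ.+-identityʳ _)
keepLarge-suc a t (j ∷ k ∷ K) with ℕₚ.<-cmp k a
... | tri< k<a k≢a _ rewrite <ᵇ-true k<a | <ᵇ-true (ℕₚ.m≤n⇒m≤1+n k<a) | ≡ᵇ-false k≢a = ≡.sym (ℕₚ.+-identityʳ _)
... | tri> _ k≢a a<k rewrite <ᵇ-false (ℕₚ.<⇒≤ a<k) | <ᵇ-false a<k | ≡ᵇ-false k≢a = ≡.sym (ℕₚ.+-identityʳ _)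
... | tri≈ _ ≡.refl _ rewrite <ᵇ-false (ℕₚ.≤-refl {k}) | <ᵇ-true (ℕₚ.n<1+n k) | ≡ᵇ-refl k with t ≤ᵇ j
...   | true  = ≡.trans (ℕₚ.+-comm (ΘK (j ∷ k ∷ K) t ℕ.* wK (j ∷ k ∷ K)) _) (≡.sym (ℕₚ.*-distribʳ-+ (wK (j ∷ k ∷ K)) k _))
...   | false = ℕₚ.+-identityʳ _

-- Expansions of path, tadpole and clique weights over compositions

module Expansion {c ℓ} (R : CommutativeRing c ℓ) {N : ℕ} (X : Fin N → CommutativeRing.Carrier R) where

  open CommutativeRing R hiding (zero)
  open Scalars R
  open Transfer R X using (e; L; Q; Q-zero; Q-suc; L-zero; L-cycle; L-path)
  open Antidiagonal +-commutativeMonoid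
  open ListSum +-commutativeMonoid
  open CompositionSum +-commutativeMonoid
  open SetoidReasoning setoid
  open import Algebra.Properties.Group +-group using () renaming (∙-cancelʳ to +-cancelʳ)
  open import Algebra.Solver.Ring.NaturalCoefficients.Default commutativeSemiring

  eProd : List ℕ → Carrier
  eProd = foldr (λ k p → e k * p) 1#

  wt : (List ℕ → ℕ) → List ℕ → Carrier
  wt d K = ι (d K) * eProd K

  E[_] : (List ℕ → ℕ) → ℕ → Carrier
  E[ d ] n = S n (wt d)

  E-cong : ∀ n {d d′} → (∀ {K} → IsComp n K → d K ≡ d′ K) → E[ d ] n ≈ E[ d′ ] n
  E-cong n eq = S-cong n (λ c → *-congʳ (ι-cong (eq c)))

  E-+ : ∀ n d d′ → E[ (λ K → d K ℕ.+ d′ K) ] n ≈ E[ d ] n + E[ d′ ] n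
  E-+ n d d′ = trans (Σ-cong (λ K → trans (*-congʳ (ι-+ (d K) (d′ K))) (distribʳ _ _ _)) (comps n)) (Σ-∙ (wt d) (wt d′) (comps n))

  S-scale : ∀ x n f → x * S n f ≈ S n (λ K → x * f K)
  S-scale x n f = Σ-homo (x *_) (zeroʳ x) (distribˡ x) f (comps n)

  E-const-zero : ∀ n → E[ (λ _ → 0) ] n ≈ 0#
  E-const-zero n = Σ-ε (λ K → zeroˡ _) (comps n)

  anti-scaleʳ : ∀ n h x → anti n h * x ≈ anti n (λ i r → h i r * x)
  anti-scaleʳ n h x = anti-homo (_* x) (distribʳ x) n h

  E-insertSecond : ∀ n d d′ k x → (∀ {K} → IsComp (suc n) K → d (insertSecond k K) ≡ x ℕ.* d′ K) →
                   S (suc n) (λ K → wt d (insertSecond k K)) ≈ (ι x * e k) * E[ d′ ] (suc n)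
  E-insertSecond n d d′ k x eq = trans (S-cong (suc n) (λ {K} c → go K c)) (sym (S-scale (ι x * e k) (suc n) (wt d′)))
    where
    go : ∀ K → IsComp (suc n) K → wt d (insertSecond k K) ≈ (ι x * e k) * wt d′ K
    go (j ∷ J) c = begin
      ι (d (j ∷ k ∷ J)) * (e j * (e k * eProd J))
        ≈⟨ *-congʳ (trans (ι-cong (eq c)) (ι-* x (d′ (j ∷ J)))) ⟩
      (ι x * ι (d′ (j ∷ J))) * (e j * (e k * eProd J))
        ≈⟨ solve 5 (λ p q r s u → (p :* q) :* (r :* (s :* u)) := (p :* s) :* (q :* (r :* u))) refl (ι x) (ι (d′ (j ∷ J))) (e j) (e k) (eProd J) ⟩
      (ι x * e k) * (ι (d′ (j ∷ J)) * (e j * eProd J)) ∎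

  wK-insertSecond : ∀ {n K} i → IsComp (suc n) K → wK (insertSecond (suc i) K) ≡ i ℕ.* wK K
  wK-insertSecond i (_∷_ j {K = K} c) = x∙yz≈y∙xz (suc j) i (prodMinus1 K)
    where open import Algebra.Properties.CommutativeSemigroup ℕₚ.*-commutativeSemigroup using (x∙yz≈y∙xz)

  wt-singleton : ∀ d n → wt d (n ∷ []) ≈ ι (d (n ∷ [])) * e n
  wt-singleton d n = *-congˡ (*-identityʳ (e n))

  W-second : ∀ m → E[ wK ] (suc (suc m)) ≈ anti m (λ i r → (ι i * e (suc i)) * E[ wK ] (suc r)) + ι (suc (suc m)) * e (suc (suc m))
  W-second m = trans (S-second m (wt wK)) (+-cong
    (anti-cong m (λ i r _ → E-insertSecond r wK wK (suc i) i (wK-insertSecond i)))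
    (trans (wt-singleton wK (suc (suc m))) (*-congʳ (ι-cong (ℕₚ.*-identityʳ (suc (suc m)))))))

  -- Iterating `Q-suc` raises k by one at a time and emits one product at each step, so k has to be
  -- general. At k = 0 the result is the recurrence of `W-second`, which identifies the two in
  -- `Q-path`.
  Q-second : ∀ m k → Q k (suc m) ≈ anti m (λ i r → (ι (k ℕ.+ i) * e (suc (k ℕ.+ i))) * Q 0 r) + ι (k ℕ.+ suc (suc m)) * e (k ℕ.+ suc (suc m))
  Q-second zero    k = begin
    Q k 1
      ≈⟨ trans (Q-suc k 0) (+-comm _ _) ⟩
    ι k * e (suc k) * Q 0 0 + Q (suc k) 0
      ≈⟨ +-cong (reflexive (cong (λ u → (ι u * e (suc u)) * Q 0 0) (≡.sym (ℕₚ.+-identityʳ k))))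
           (trans (Q-zero (suc k)) (reflexive (cong (λ u → ι u * e u) (ℕₚ.+-comm 2 k)))) ⟩
    (ι (k ℕ.+ 0) * e (suc (k ℕ.+ 0))) * Q 0 0 + ι (k ℕ.+ 2) * e (k ℕ.+ 2) ∎
  Q-second (suc m) k = begin
    Q k (suc (suc m))
      ≈⟨ trans (Q-suc k (suc m)) (+-comm _ _) ⟩
    ι k * e (suc k) * Q 0 (suc m) + Q (suc k) (suc m)
      ≈⟨ +-cong (reflexive (cong (λ u → (ι u * e (suc u)) * Q 0 (suc m)) (≡.sym (ℕₚ.+-identityʳ k)))) (trans (Q-second m (suc k)) (+-cong
           (anti-cong m (λ i r _ → reflexive (cong (λ u → (ι u * e (suc u)) * Q 0 r) (≡.sym (ℕₚ.+-suc k i)))))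
           (reflexive (cong (λ u → ι u * e u) (≡.sym (ℕₚ.+-suc k (suc (suc m)))))))) ⟩
    (ι (k ℕ.+ 0) * e (suc (k ℕ.+ 0))) * Q 0 (suc m)
      + (anti m (λ i r → (ι (k ℕ.+ suc i) * e (suc (k ℕ.+ suc i))) * Q 0 r) + ι (k ℕ.+ suc (suc (suc m))) * e (k ℕ.+ suc (suc (suc m))))
      ≈⟨ +-assoc _ _ _ ⟨
    anti (suc m) (λ i r → (ι (k ℕ.+ i) * e (suc (k ℕ.+ i))) * Q 0 r) + ι (k ℕ.+ suc (suc (suc m))) * e (k ℕ.+ suc (suc (suc m))) ∎

  Q-path : ∀ m → Q 0 m ≈ E[ wK ] (suc m)
  Q-path m = go m m ℕₚ.≤-refl
    where
    go : ∀ n m → m ℕ.≤ n → Q 0 m ≈ E[ wK ] (suc m)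
    go n       zero    _         = trans (Q-zero 0) (sym (trans (+-identityʳ _) (wt-singleton wK 1)))
    go (suc n) (suc m) (s≤s m≤n) = begin
      Q 0 (suc m)
        ≈⟨ Q-second m 0 ⟩
      anti m (λ i r → (ι i * e (suc i)) * Q 0 r) + ι (suc (suc m)) * e (suc (suc m))
        ≈⟨ +-congʳ (anti-cong m (λ i r i+r≡m → *-congˡ (go n r (ℕₚ.≤-trans (ℕₚ.m+n≤o⇒n≤o i (ℕₚ.≤-reflexive i+r≡m)) m≤n)))) ⟩
      anti m (λ i r → (ι i * e (suc i)) * E[ wK ] (suc r)) + ι (suc (suc m)) * e (suc (suc m))
        ≈⟨ W-second m ⟨
      E[ wK ] (suc (suc m)) ∎

  -- This covers `wK` (p the identity) and `prodMinus1` (p the predecessor) at once: without the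
  -- first part, both leave `prodMinus1`.
  firstWt : (ℕ → ℕ) → List ℕ → ℕ
  firstWt p []      = 1
  firstWt p (k ∷ K) = p k ℕ.* prodMinus1 K

  module Split (s : ℕ) where

    -- `nextPart K 0` is the first part of K. By `C-cycle` and the later `L-tadpole`, C is the
    -- weight of a cycle with s+1 vertices.
    C : Carrier
    C = E[ (λ K → nextPart K 0 ℕ.* prodMinus1 K) ] (suc s)

    -- The factor `nextPart K t` keeps only the K that break at t, that is, the concatenations of a
    -- composition of t with one of s+1. For the weights d used below the summand then factors: the
    -- first part k of the second piece brings k from `nextPart` and k - 1 from d.
    SplitAt : (List ℕ → ℕ) → ℕ → Set ℓ
    SplitAt d t = E[ (λ K → nextPart K t ℕ.* d K) ] (t ℕ.+ suc s) ≈ E[ d ] t * C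

    wt-∷ : ∀ x y k d K {z} → z ≡ x ℕ.* y → d K ≡ y → ι z * (e k * eProd K) ≈ (ι x * e k) * wt d K
    wt-∷ x y k d K ≡.refl ≡.refl = trans (*-congʳ (ι-* x y))
      (solve 4 (λ p q r u → (p :* q) :* (r :* u) := (p :* r) :* (q :* u)) refl (ι x) (ι y) (e k) (eProd K))

    split-suc : ∀ p t → (∀ r → r ℕ.≤ t → SplitAt prodMinus1 r) → SplitAt (firstWt p) (suc t)
    split-suc p t ih = begin
      E[ d ] (suc (t ℕ.+ suc s))
        ≈⟨ S-suc (t ℕ.+ suc s) (wt d) ⟩
      anti (t ℕ.+ suc s) (λ i r → S r (λ K → wt d (suc i ∷ K)))
        ≈⟨ anti-truncate t (suc s) _ (λ i r t<i → Σ-ε (beyond i t<i) (comps r)) ⟩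
      anti t (λ i r → S (r ℕ.+ suc s) (λ K → wt d (suc i ∷ K)))
        ≈⟨ anti-cong t (λ i r i+r≡t → trans (Σ-cong (within i r i+r≡t) (comps (r ℕ.+ suc s))) (sym (S-scale _ (r ℕ.+ suc s) _))) ⟩
      anti t (λ i r → (ι (p (suc i)) * e (suc i)) * E[ (λ K → nextPart K r ℕ.* prodMinus1 K) ] (r ℕ.+ suc s))
        ≈⟨ anti-cong t (λ i r i+r≡t → trans (*-congˡ (ih r (ℕₚ.m+n≤o⇒n≤o i (ℕₚ.≤-reflexive i+r≡t)))) (sym (*-assoc _ _ _))) ⟩
      anti t (λ i r → ((ι (p (suc i)) * e (suc i)) * E[ prodMinus1 ] r) * C)
        ≈⟨ anti-scaleʳ t _ C ⟨
      anti t (λ i r → (ι (p (suc i)) * e (suc i)) * E[ prodMinus1 ] r) * C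
        ≈⟨ *-congʳ (anti-cong t (λ i r _ → trans (S-scale _ r (wt prodMinus1))
             (Σ-cong (λ K → sym (wt-∷ (p (suc i)) (prodMinus1 K) (suc i) prodMinus1 K ≡.refl ≡.refl)) (comps r)))) ⟩
      anti t (λ i r → S r (λ K → wt (firstWt p) (suc i ∷ K))) * C
        ≈⟨ *-congʳ (S-suc t (wt (firstWt p))) ⟨
      E[ firstWt p ] (suc t) * C ∎
      where
      d : List ℕ → ℕ
      d K = nextPart K (suc t) ℕ.* firstWt p K
      beyond : ∀ i → t ℕ.< i → ∀ K → wt d (suc i ∷ K) ≈ 0#
      beyond i t<i K rewrite nextPart-big (suc i) K t (s≤s t<i) = zeroˡ _
      within : ∀ i r → i ℕ.+ r ≡ t → ∀ K → wt d (suc i ∷ K) ≈ (ι (p (suc i)) * e (suc i)) * wt (λ K → nextPart K r ℕ.* prodMinus1 K) K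
      within i r ≡.refl K = wt-∷ (p (suc i)) (nextPart K r ℕ.* prodMinus1 K) (suc i) (λ K → nextPart K r ℕ.* prodMinus1 K) K
        (≡.trans (cong (ℕ._* (p (suc i) ℕ.* prodMinus1 K)) next≡) (x∙yz≈y∙xz (nextPart K r) (p (suc i)) (prodMinus1 K))) ≡.refl
        where
        open import Algebra.Properties.CommutativeSemigroup ℕₚ.*-commutativeSemigroup using (x∙yz≈y∙xz)
        next≡ : nextPart (suc i ∷ K) (suc (i ℕ.+ r)) ≡ nextPart K r
        next≡ = ≡.trans (nextPart-small (suc i) K (i ℕ.+ r) (s≤s (ℕₚ.m≤m+n i r))) (cong (nextPart K) (ℕₚ.m+n∸m≡n i r))

    firstWt-pred : ∀ K → prodMinus1 K ≡ firstWt (_∸ 1) K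
    firstWt-pred []      = ≡.refl
    firstWt-pred (k ∷ K) = ≡.refl

    firstWt-id : ∀ K → wK K ≡ firstWt id K
    firstWt-id []      = ≡.refl
    firstWt-id (k ∷ K) = ≡.refl

    SplitAt-cong : ∀ {d d′} t → (∀ K → d K ≡ d′ K) → SplitAt d′ t → SplitAt d t
    SplitAt-cong {d} {d′} t eq split = trans (E-cong (t ℕ.+ suc s) (λ {K} _ → cong (nextPart K t ℕ.*_) (eq K)))
      (trans split (*-congʳ (sym (E-cong t (λ {K} _ → eq K)))))

    split-prodMinus1 : ∀ n t → t ℕ.≤ n → SplitAt prodMinus1 t
    split-prodMinus1 n zero _ = sym (trans (*-congʳ one) (*-identityˡ C))
      where
      one : E[ prodMinus1 ] 0 ≈ 1#
      one = solve 0 ((con 1 :+ con 0) :* con 1 :+ con 0 := con 1) refl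
    split-prodMinus1 (suc n) (suc t) (s≤s t≤n) = SplitAt-cong (suc t) firstWt-pred
      (split-suc (_∸ 1) t (λ r r≤t → split-prodMinus1 n r (ℕₚ.≤-trans r≤t t≤n)))

    split-wK : ∀ t → SplitAt wK (suc t)
    split-wK t = SplitAt-cong (suc t) firstWt-id (split-suc id t (λ r _ → split-prodMinus1 r r ℕₚ.≤-refl))

    C-cycle : C ≈ E[ (λ K → ΘK K 1 ℕ.* wK K) ] (suc s)
    C-cycle = E-cong (suc s) go
      where
      open import Algebra.Properties.CommutativeSemigroup ℕₚ.*-commutativeSemigroup using (x∙yz≈y∙xz)
      go : ∀ {K} → IsComp (suc s) K → nextPart K 0 ℕ.* prodMinus1 K ≡ ΘK K 1 ℕ.* wK K
      go (_∷_ i {K = K} _) rewrite ΘK-big (suc i) K 0 (s≤s z≤n) = x∙yz≈y∙xz (suc i) i (prodMinus1 K)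

  tadpoleWt : ℕ → List ℕ → ℕ
  tadpoleWt t K = ΘK K t ℕ.* wK K

  -- This is `ΘK-suc` times w, summed over K; `split-wK` factors the `nextPart` term into a path
  -- times a cycle. The result has the form of `L-cycle`.
  Θ-difference : ∀ t s → let n = suc t ℕ.+ suc s in
    E[ tadpoleWt (suc t) ] n + E[ wK ] (suc t) * E[ tadpoleWt 1 ] (suc s) ≈ E[ wK ] n + E[ tadpoleWt (suc (suc t)) ] n
  Θ-difference t s = begin
    E[ tadpoleWt (suc t) ] n + E[ wK ] (suc t) * E[ tadpoleWt 1 ] (suc s)
      ≈⟨ +-congˡ (trans (*-congˡ (sym C-cycle)) (sym (split-wK t))) ⟩
    E[ tadpoleWt (suc t) ] n + E[ (λ K → nextPart K (suc t) ℕ.* wK K) ] n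
      ≈⟨ E-+ n (tadpoleWt (suc t)) (λ K → nextPart K (suc t) ℕ.* wK K) ⟨
    E[ (λ K → tadpoleWt (suc t) K ℕ.+ nextPart K (suc t) ℕ.* wK K) ] n
      ≈⟨ E-cong n (λ {K} c → ≡.trans (≡.sym (ℕₚ.*-distribʳ-+ (wK K) (ΘK K (suc t)) (nextPart K (suc t))))
           (cong (ℕ._* wK K) (ΘK-suc c (suc t) (ℕₚ.m<m+n (suc t) (s≤s z≤n))))) ⟩
    E[ (λ K → wK K ℕ.+ tadpoleWt (suc (suc t)) K) ] n
      ≈⟨ E-+ n wK (tadpoleWt (suc (suc t))) ⟩
    E[ wK ] n + E[ tadpoleWt (suc (suc t)) ] n ∎
    where
    open Split s
    n = suc t ℕ.+ suc s

  -- Both sides obey the same recurrence, by `L-cycle` and `Θ-difference`. It lowers m but calls b =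
  -- 0 and b+1, so the induction keeps b general. At m = 0 the cycle is a loop, which has no proper
  -- colouring, and Θ vanishes at t = n.
  L-tadpole : ∀ m b → L 0 b m ≈ E[ tadpoleWt (suc b) ] (suc b ℕ.+ m)
  L-tadpole zero    b = trans (L-zero b) (sym (trans
    (E-cong (suc b ℕ.+ 0) {d′ = λ _ → 0} (λ {K} c → cong (ℕ._* wK K) (≡.trans (cong (ΘK K) (≡.sym (ℕₚ.+-identityʳ (suc b)))) (ΘK-full c))))
    (E-const-zero (suc b ℕ.+ 0))))
  L-tadpole (suc m) b = +-cancelʳ (E[ wK ] (suc b) * E[ tadpoleWt 1 ] (suc m)) _ _ (begin
    L 0 b (suc m) + E[ wK ] (suc b) * E[ tadpoleWt 1 ] (suc m)
      ≈⟨ +-congˡ (trans (*-comm _ _) (*-cong (sym (L-tadpole m 0)) (sym (Q-path b)))) ⟩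
    L 0 b (suc m) + L 0 0 m * Q 0 b
      ≈⟨ L-cycle b m ⟩
    Q 0 (b ℕ.+ suc m) + L 0 (suc b) m
      ≈⟨ +-cong (Q-path (b ℕ.+ suc m)) (trans (L-tadpole m (suc b)) (reflexive (cong E[ tadpoleWt (suc (suc b)) ] (≡.sym (ℕₚ.+-suc (suc b) m))))) ⟩
    E[ wK ] (suc b ℕ.+ suc m) + E[ tadpoleWt (suc (suc b)) ] (suc b ℕ.+ suc m)
      ≈⟨ Θ-difference b m ⟨
    E[ tadpoleWt (suc b) ] (suc b ℕ.+ suc m) + E[ wK ] (suc b) * E[ tadpoleWt 1 ] (suc m) ∎)

  -- Inserting a+1 as second part multiplies w by a. By `ΘK-insertSecond` the bracket in `secondIs`
  -- is Θ of the original composition at the threshold lowered by a+1, from a+b+2 to b+1, and this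
  -- is the coefficient of the tadpole with tail b.
  E-secondIs : ∀ a b m → let n = a ℕ.+ suc b ℕ.+ suc m in
    E[ secondIs (suc a) (suc (a ℕ.+ suc b)) ] n ≈ ι a * e (suc a) * L 0 b m
  E-secondIs a b m = begin
    E[ d ] (a ℕ.+ suc b ℕ.+ suc m)
      ≈⟨ reflexive (cong E[ d ] n≡) ⟩
    E[ d ] (suc (suc (a ℕ.+ (b ℕ.+ m))))
      ≈⟨ trans (S-second (a ℕ.+ (b ℕ.+ m)) (wt d)) (trans (+-congˡ (zeroˡ _)) (+-identityʳ _)) ⟩
    anti (a ℕ.+ (b ℕ.+ m)) (λ i r → S (suc r) (λ K → wt d (insertSecond (suc i) K)))
      ≈⟨ anti-pick a (b ℕ.+ m) _ (λ i r i≢a → trans (S-cong (suc r) (off i r i≢a)) (Σ-ε (λ _ → refl) (comps (suc r)))) ⟩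
    S (suc (b ℕ.+ m)) (λ K → wt d (insertSecond (suc a) K))
      ≈⟨ E-insertSecond (b ℕ.+ m) d (tadpoleWt (suc b)) (suc a) a on ⟩
    (ι a * e (suc a)) * E[ tadpoleWt (suc b) ] (suc b ℕ.+ m)
      ≈⟨ *-congˡ (L-tadpole m b) ⟨
    ι a * e (suc a) * L 0 b m ∎
    where
    open import Algebra.Properties.CommutativeSemigroup ℕₚ.*-commutativeSemigroup using (x∙yz≈y∙xz)
    d : List ℕ → ℕ
    d = secondIs (suc a) (suc (a ℕ.+ suc b))
    n≡ : a ℕ.+ suc b ℕ.+ suc m ≡ suc (suc (a ℕ.+ (b ℕ.+ m)))
    n≡ = ≡.trans (ℕₚ.+-suc (a ℕ.+ suc b) m) (cong suc (≡.trans (cong (ℕ._+ m) (ℕₚ.+-suc a b)) (cong suc (ℕₚ.+-assoc a b m))))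
    off : ∀ i r → i ≢ a → ∀ {K} → IsComp (suc r) K → wt d (insertSecond (suc i) K) ≈ 0#
    off i r i≢a (_ ∷ _) rewrite ≡ᵇ-false i≢a = zeroˡ _
    on : ∀ {n K} → IsComp (suc n) K → d (insertSecond (suc a) K) ≡ a ℕ.* tadpoleWt (suc b) K
    on c@(_∷_ j {K = J} _) rewrite ≡ᵇ-refl a = ≡.trans
      (cong₂ ℕ._*_ (ΘK-insertSecond (suc j) a J b) (wK-insertSecond a c))
      (x∙yz≈y∙xz (ΘK (suc j ∷ J) (suc b)) a (wK (suc j ∷ J)))

  -- `L-path` trades one edge of the path for one more clique vertex, so t stays fixed along the
  -- induction. Its correction term δ is the `secondIs` sum, which `keepLarge-suc` distributes. At a
  -- = 0 nothing is excluded, since no part is below 1.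
  L-keepLarge : ∀ a b m → let n = a ℕ.+ b ℕ.+ suc m ; t = suc (a ℕ.+ b) in
    L a b m + E[ excess (suc a) t ] n ≈ E[ keepLarge (suc a) t ] n
  L-keepLarge zero b m = begin
    L 0 b m + E[ excess 1 (suc b) ] (b ℕ.+ suc m)
      ≈⟨ +-cong (trans (L-tadpole m b) (reflexive (cong E[ tadpoleWt (suc b) ] (≡.sym (ℕₚ.+-suc b m)))))
           (trans (E-cong (b ℕ.+ suc m) excess≡) (E-const-zero (b ℕ.+ suc m))) ⟩
    E[ tadpoleWt (suc b) ] (b ℕ.+ suc m) + 0#
      ≈⟨ +-identityʳ _ ⟩
    E[ tadpoleWt (suc b) ] (b ℕ.+ suc m)
      ≈⟨ E-cong (b ℕ.+ suc m) keep≡ ⟩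
    E[ keepLarge 1 (suc b) ] (b ℕ.+ suc m) ∎
    where
    excess≡ : ∀ {n K} → IsComp n K → excess 1 (suc b) K ≡ 0
    excess≡ []          = ≡.refl
    excess≡ (_ ∷ [])    = ≡.refl
    excess≡ (_ ∷ _ ∷ _) = ≡.refl
    keep≡ : ∀ {n K} → IsComp n K → tadpoleWt (suc b) K ≡ keepLarge 1 (suc b) K
    keep≡ []          = ≡.refl
    keep≡ (_ ∷ [])    = ≡.refl
    keep≡ (_ ∷ _ ∷ _) = ≡.refl
  L-keepLarge (suc a) b m = +-cancelʳ (E[ excess (suc a) t ] n + δ) _ _ (begin
    (L (suc a) b m + E[ excess (suc (suc a)) t ] n) + (E[ excess (suc a) t ] n + δ)
      ≈⟨ solve 4 (λ p q r u → (p :+ q) :+ (r :+ u) := ((p :+ u) :+ r) :+ q) refl (L (suc a) b m) (E[ excess (suc (suc a)) t ] n) (E[ excess (suc a) t ] n) δ ⟩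
    ((L (suc a) b m + δ) + E[ excess (suc a) t ] n) + E[ excess (suc (suc a)) t ] n
      ≈⟨ +-congʳ (+-congʳ (L-path a b m)) ⟨
    (L a (suc b) m + E[ excess (suc a) t ] n) + E[ excess (suc (suc a)) t ] n
      ≈⟨ +-congʳ (reindex (λ n t → L a (suc b) m + E[ excess (suc a) t ] n)) ⟩
    (L a (suc b) m + E[ excess (suc a) t′ ] n′) + E[ excess (suc (suc a)) t ] n
      ≈⟨ +-congʳ (L-keepLarge a (suc b) m) ⟩
    E[ keepLarge (suc a) t′ ] n′ + E[ excess (suc (suc a)) t ] n
      ≈⟨ +-congʳ (reindex (λ n t → E[ keepLarge (suc a) t ] n)) ⟨
    E[ keepLarge (suc a) t ] n + E[ excess (suc (suc a)) t ] n
      ≈⟨ E-+ n (keepLarge (suc a) t) (excess (suc (suc a)) t) ⟨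
    E[ (λ K → keepLarge (suc a) t K ℕ.+ excess (suc (suc a)) t K) ] n
      ≈⟨ E-cong n (λ {K} _ → keepLarge-suc (suc a) t K) ⟩
    E[ (λ K → (keepLarge (suc (suc a)) t K ℕ.+ excess (suc a) t K) ℕ.+ secondIs (suc a) t K) ] n
      ≈⟨ trans (E-+ n (λ K → keepLarge (suc (suc a)) t K ℕ.+ excess (suc a) t K) (secondIs (suc a) t)) (+-congʳ (E-+ n (keepLarge (suc (suc a)) t) (excess (suc a) t))) ⟩
    (E[ keepLarge (suc (suc a)) t ] n + E[ excess (suc a) t ] n) + E[ secondIs (suc a) t ] n
      ≈⟨ trans (+-assoc _ _ _) (+-congˡ (+-congˡ (trans (reindex (λ n t → E[ secondIs (suc a) t ] n)) (E-secondIs a b m)))) ⟩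
    E[ keepLarge (suc (suc a)) t ] n + (E[ excess (suc a) t ] n + δ) ∎)
    where
    n t n′ t′ : ℕ
    n = suc a ℕ.+ b ℕ.+ suc m
    t = suc (suc a ℕ.+ b)
    n′ = a ℕ.+ suc b ℕ.+ suc m
    t′ = suc (a ℕ.+ suc b)
    δ : Carrier
    δ = ι a * e (suc a) * L 0 b m
    reindex : ∀ (f : ℕ → ℕ → Carrier) → f n t ≈ f n′ t′
    reindex f = reflexive (cong (λ u → f (u ℕ.+ suc m) (suc u)) (≡.sym (ℕₚ.+-suc a b)))

-- The coefficients c_K w_K as natural numbers

open ≡ using (refl; sym; trans)

-- The natural number c_K w_K; the factor k₂ ∸ 1 of w_K clears the denominator of c_K.
coef : ℕ → ℕ → List ℕ → ℕ
coef a b (k₁ ∷ k₂ ∷ K) =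
  if k₂ <ᵇ a then 0
  else if (k₁ ≤ᵇ a ∸ 1) ∧ (a ℕ.+ b ≤ᵇ k₂)
    then ((k₂ ∸ (a ℕ.+ b)) ℕ.* (k₂ ∸ 1) ℕ.+ (k₂ ∸ k₁)) ℕ.* (k₁ ℕ.* prodMinus1 K)
    else ΘK (k₁ ∷ k₂ ∷ K) (a ℕ.+ b) ℕ.* wK (k₁ ∷ k₂ ∷ K)
coef a b K = ΘK K (a ℕ.+ b) ℕ.* wK K

≤ᵇ-elim : ∀ {m n} → (m ≤ᵇ n) ≡ true → m ℕ.≤ n
≤ᵇ-elim {m} {n} eq = ℕₚ.≤ᵇ⇒≤ m n (≡.subst T (sym eq) _)

-- With k₁ = i+1 and k₂ = k one has Θ = k₁+k₂-t. Taking the exchanged remainder k₁k₂(k₁-1) away from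
-- Θ k₁(k₂-1) and dividing by k₁(k₂-1) gives k₂-t+1-(k₁-1)/(k₂-1) = k₂-t+(k₂-k₁)/(k₂-1), which is
-- the exceptional coefficient at t = a+b.
coef-exceptional : ∀ i w u K t k → t ≡ suc i ℕ.+ suc w → k ≡ t ℕ.+ u →
  ((k ∸ t) ℕ.* (k ∸ 1) ℕ.+ (k ∸ suc i)) ℕ.* (suc i ℕ.* prodMinus1 K) ℕ.+ suc i ℕ.* (k ℕ.* (i ℕ.* prodMinus1 K))
    ≡ ΘK (suc i ∷ k ∷ K) t ℕ.* wK (suc i ∷ k ∷ K)
coef-exceptional i w u K t k refl refl = begin
  ((k ∸ t) ℕ.* q ℕ.+ (k ∸ suc i)) ℕ.* (suc i ℕ.* P) ℕ.+ suc i ℕ.* (k ℕ.* (i ℕ.* P))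
    ≡⟨ cong₂ (λ x y → (x ℕ.* q ℕ.+ y) ℕ.* (suc i ℕ.* P) ℕ.+ suc i ℕ.* (k ℕ.* (i ℕ.* P))) (ℕₚ.m+n∸m≡n t u) k∸i ⟩
  (u ℕ.* q ℕ.+ (suc w ℕ.+ u)) ℕ.* (suc i ℕ.* P) ℕ.+ suc i ℕ.* (k ℕ.* (i ℕ.* P))
    ≡⟨ identity i w u P ⟩
  (suc i ℕ.+ u) ℕ.* (suc i ℕ.* (q ℕ.* P))
    ≡⟨ cong (ℕ._* (suc i ℕ.* (q ℕ.* P))) Θ≡ ⟨
  ΘK (suc i ∷ k ∷ K) t ℕ.* (suc i ℕ.* (q ℕ.* P)) ∎
  where
  open ≡-Reasoning
  P q : ℕ
  P = prodMinus1 K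
  q = i ℕ.+ suc w ℕ.+ u
  k∸i : k ∸ suc i ≡ suc w ℕ.+ u
  k∸i = trans (cong (_∸ suc i) (ℕₚ.+-assoc (suc i) (suc w) u)) (ℕₚ.m+n∸m≡n (suc i) (suc w ℕ.+ u))
  rearrange : ∀ x y z → x ℕ.+ y ℕ.+ z ≡ y ℕ.+ (x ℕ.+ z)
  rearrange = solve-∀
  identity : ∀ i w u P →
    (u ℕ.* (i ℕ.+ suc w ℕ.+ u) ℕ.+ (suc w ℕ.+ u)) ℕ.* (suc i ℕ.* P) ℕ.+ suc i ℕ.* ((suc i ℕ.+ suc w ℕ.+ u) ℕ.* (i ℕ.* P))
      ≡ (suc i ℕ.+ u) ℕ.* (suc i ℕ.* ((i ℕ.+ suc w ℕ.+ u) ℕ.* P))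
  identity = solve-∀
  Θ≡ : ΘK (suc i ∷ k ∷ K) t ≡ suc i ℕ.+ u
  Θ≡ = begin
    ΘK (suc i ∷ k ∷ K) t       ≡⟨ ΘK-small (suc i) (k ∷ K) t (ℕₚ.m≤m+n (suc i) (suc w)) ⟩
    ΘK (k ∷ K) (t ∸ suc i)     ≡⟨ cong (ΘK (k ∷ K)) (ℕₚ.m+n∸m≡n (suc i) (suc w)) ⟩
    ΘK (k ∷ K) (suc w)         ≡⟨ ΘK-big k K w (ℕₚ.≤-trans (ℕₚ.m≤n+m (suc w) (suc i)) (ℕₚ.m≤m+n t u)) ⟩
    k ∸ suc w                  ≡⟨ cong (_∸ suc w) (rearrange (suc i) (suc w) u) ⟩
    suc w ℕ.+ (suc i ℕ.+ u) ∸ suc w  ≡⟨ ℕₚ.m+n∸m≡n (suc w) (suc i ℕ.+ u) ⟩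
    suc i ℕ.+ u                ∎

-- Exchanging the first two parts moves the support of `excess` to k₁ ≤ a and k₂ ≥ a+1+b, which is
-- the exceptional case for a clique of size a+1. Elsewhere `coef` and `keepLarge` agree.
coef-excess : ∀ {n K} a b → IsComp n K →
  coef (suc a) b K ℕ.+ excess (suc a) (suc (a ℕ.+ b)) (swapHead K) ≡ keepLarge (suc a) (suc (a ℕ.+ b)) K
coef-excess a b []       = ℕₚ.+-identityʳ _
coef-excess a b (i ∷ []) = ℕₚ.+-identityʳ _
coef-excess a b (_∷_ i (_∷_ j {K = K} _)) with suc j ℕ.<? suc a
... | yes j<a rewrite <ᵇ-true j<a | ≤ᵇ-false (ℕₚ.<-≤-trans j<a (ℕₚ.m≤m+n (suc a) b)) with i <ᵇ a
...   | true  = refl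
...   | false = refl
coef-excess a b (_∷_ i (_∷_ j {K = K} _)) | no j≮a rewrite <ᵇ-false (ℕₚ.≮⇒≥ j≮a) with suc i ≤ᵇ a in eq₁ | suc (a ℕ.+ b) ≤ᵇ suc j in eq₂
... | true  | true
  with v , i+v≡a ← ℕₚ.m≤n⇒∃[o]m+o≡n (≤ᵇ-elim {suc i} {a} eq₁) | u , t+u≡j ← ℕₚ.m≤n⇒∃[o]m+o≡n (≤ᵇ-elim {suc (a ℕ.+ b)} {suc j} eq₂) =
  coef-exceptional i (v ℕ.+ b) u K (suc (a ℕ.+ b)) (suc j) t≡ (sym t+u≡j)
  where
  t≡ : suc (a ℕ.+ b) ≡ suc i ℕ.+ suc (v ℕ.+ b)
  t≡ = trans (cong (λ z → suc (z ℕ.+ b)) (sym i+v≡a)) (trans (cong suc (ℕₚ.+-assoc (suc i) v b)) (sym (ℕₚ.+-suc (suc i) (v ℕ.+ b))))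
... | true  | false = ℕₚ.+-identityʳ _
... | false | _     = ℕₚ.+-identityʳ _

-- Comparison with the rational coefficients c_K

/1-homo-+ : ∀ x y → (x ℤ.+ y) / 1 ≡ (x / 1) ℚ.+ (y / 1)
/1-homo-+ x y = ℚₚ.toℚᵘ-injective (begin
  toℚᵘ ((x ℤ.+ y) / 1)                 ≈⟨ ℚₚ.toℚᵘ-fromℚᵘ (ℚᵘ.mkℚᵘ (x ℤ.+ y) 0) ⟩
  ℚᵘ.mkℚᵘ (x ℤ.+ y) 0                  ≈⟨ ℚᵘ.*≡* (identity x y) ⟩
  ℚᵘ.mkℚᵘ x 0 ℚᵘ.+ ℚᵘ.mkℚᵘ y 0         ≈⟨ ℚᵘₚ.+-cong (ℚₚ.toℚᵘ-fromℚᵘ (ℚᵘ.mkℚᵘ x 0)) (ℚₚ.toℚᵘ-fromℚᵘ (ℚᵘ.mkℚᵘ y 0)) ⟨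
  toℚᵘ (x / 1) ℚᵘ.+ toℚᵘ (y / 1)       ≈⟨ ℚₚ.toℚᵘ-homo-+ (x / 1) (y / 1) ⟨
  toℚᵘ ((x / 1) ℚ.+ (y / 1))           ∎)
  where
  open SetoidReasoning ℚᵘₚ.≃-setoid
  identity : ∀ x y → (x ℤ.+ y) ℤ.* (+ 1) ≡ (x ℤ.* + 1 ℤ.+ y ℤ.* + 1) ℤ.* + 1
  identity = ℤ-Solver.solve-∀

/-*-/1 : ∀ x y d → (x / suc d) ℚ.* (y / 1) ≡ (x ℤ.* y) / suc d
/-*-/1 x y d = ℚₚ.toℚᵘ-injective (begin
  toℚᵘ ((x / suc d) ℚ.* (y / 1))          ≈⟨ ℚₚ.toℚᵘ-homo-* (x / suc d) (y / 1) ⟩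
  toℚᵘ (x / suc d) ℚᵘ.* toℚᵘ (y / 1)    ≈⟨ ℚᵘₚ.*-cong (ℚₚ.toℚᵘ-fromℚᵘ (ℚᵘ.mkℚᵘ x d)) (ℚₚ.toℚᵘ-fromℚᵘ (ℚᵘ.mkℚᵘ y 0)) ⟩
  ℚᵘ.mkℚᵘ x d ℚᵘ.* ℚᵘ.mkℚᵘ y 0          ≈⟨ ℚᵘ.*≡* (cong (λ u → (x ℤ.* y) ℤ.* + suc u) (sym (ℕₚ.*-identityʳ d))) ⟩
  ℚᵘ.mkℚᵘ (x ℤ.* y) d                   ≈⟨ ℚₚ.toℚᵘ-fromℚᵘ (ℚᵘ.mkℚᵘ (x ℤ.* y) d) ⟨
  toℚᵘ ((x ℤ.* y) / suc d)              ∎)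
  where open SetoidReasoning ℚᵘₚ.≃-setoid

frac-cancel : ∀ x {d} → 1 ℕ.≤ d → frac x d ℚ.* ℕtoℚ d ≡ x / 1
frac-cancel x {suc d} _ = trans (/-*-/1 x (+ suc d) d) (ℚₚ.fromℚᵘ-cong {ℚᵘ.mkℚᵘ (x ℤ.* + suc d) d} {ℚᵘ.mkℚᵘ x 0} (ℚᵘ.*≡* (ℤₚ.*-identityʳ (x ℤ.* + suc d))))

ℕtoℚ-+ : ∀ m n → ℕtoℚ (m ℕ.+ n) ≡ ℕtoℚ m ℚ.+ ℕtoℚ n
ℕtoℚ-+ m n = /1-homo-+ (+ m) (+ n)

ℕtoℚ-* : ∀ m n → ℕtoℚ (m ℕ.* n) ≡ ℕtoℚ m ℚ.* ℕtoℚ n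
ℕtoℚ-* m n = trans (cong (_/ 1) (ℤₚ.pos-* m n)) (sym (/-*-/1 (+ m) (+ n) 0))

ℕtoℚ-nonNeg : ∀ n → 0ℚ ℚ.≤ ℕtoℚ n
ℕtoℚ-nonNeg n = ℚₚ.nonNegative⁻¹ (ℕtoℚ n) {{ℚₚ.normalize-nonNeg n 1}}

cK-exceptional : ∀ u d x y P (F : ℚ) → F ℚ.* ℕtoℚ d ≡ ℕtoℚ x →
  ℕtoℚ ((u ℕ.* d ℕ.+ x) ℕ.* (y ℕ.* P)) ≡ (ℕtoℚ u ℚ.+ F) ℚ.* ℕtoℚ (y ℕ.* (d ℕ.* P))
cK-exceptional u d x y P F eq = begin
  ℕtoℚ ((u ℕ.* d ℕ.+ x) ℕ.* (y ℕ.* P))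
    ≡⟨ trans (ℕtoℚ-* (u ℕ.* d ℕ.+ x) (y ℕ.* P)) (cong₂ ℚ._*_ (trans (ℕtoℚ-+ (u ℕ.* d) x) (cong₂ ℚ._+_ (ℕtoℚ-* u d) (sym eq))) (ℕtoℚ-* y P)) ⟩
  (ℕtoℚ u ℚ.* ℕtoℚ d ℚ.+ F ℚ.* ℕtoℚ d) ℚ.* (ℕtoℚ y ℚ.* ℕtoℚ P)
    ≡⟨ solve 5 (λ u d f y p → (u :* d :+ f :* d) :* (y :* p) := (u :+ f) :* (y :* (d :* p))) refl (ℕtoℚ u) (ℕtoℚ d) F (ℕtoℚ y) (ℕtoℚ P) ⟩
  (ℕtoℚ u ℚ.+ F) ℚ.* (ℕtoℚ y ℚ.* (ℕtoℚ d ℚ.* ℕtoℚ P))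
    ≡⟨ cong ((ℕtoℚ u ℚ.+ F) ℚ.*_) (trans (ℕtoℚ-* y (d ℕ.* P)) (cong (ℕtoℚ y ℚ.*_) (ℕtoℚ-* d P))) ⟨
  (ℕtoℚ u ℚ.+ F) ℚ.* ℕtoℚ (y ℕ.* (d ℕ.* P)) ∎
  where
  open ≡-Reasoning
  open ℚ-Solver.+-*-Solver

pos-∸ : ∀ {m n} → n ℕ.≤ m → + m ℤ.- + n ≡ + (m ∸ n)
pos-∸ {m} {n} n≤m = trans (ℤₚ.m-n≡m⊖n m n) (ℤₚ.⊖-≥ n≤m)

if-ℕtoℚ : ∀ p q {x y z : ℕ} {x′ y′ z′ w : ℚ} →
  ℕtoℚ x ≡ x′ ℚ.* w → (q ≡ true → ℕtoℚ y ≡ y′ ℚ.* w) → ℕtoℚ z ≡ z′ ℚ.* w →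
  ℕtoℚ (if p then x else if q then y else z) ≡ (if p then x′ else if q then y′ else z′) ℚ.* w
if-ℕtoℚ true  q     x≡ y≡ z≡ = x≡
if-ℕtoℚ false true  x≡ y≡ z≡ = y≡ refl
if-ℕtoℚ false false x≡ y≡ z≡ = z≡

coef≡cK*wK : ∀ {n K} a b → IsComp n K → ℕtoℚ (coef (suc a) b K) ≡ cK (suc a) b K ℚ.* ℕtoℚ (wK K)
coef≡cK*wK a b []         = ℕtoℚ-* (ΘK [] (suc (a ℕ.+ b))) 1
coef≡cK*wK a b (_∷_ i []) = ℕtoℚ-* (ΘK (suc i ∷ []) (suc (a ℕ.+ b))) (wK (suc i ∷ []))
coef≡cK*wK a b (_∷_ i (_∷_ j {K = K} _)) =
  if-ℕtoℚ (suc j <ᵇ suc a) ((suc i ≤ᵇ a) ∧ (suc (a ℕ.+ b) ≤ᵇ suc j))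
    (sym (ℚₚ.*-zeroˡ (ℕtoℚ (wK (suc i ∷ suc j ∷ K)))))
    exceptional
    (ℕtoℚ-* (ΘK (suc i ∷ suc j ∷ K) (suc (a ℕ.+ b))) (wK (suc i ∷ suc j ∷ K)))
  where
  exceptional : (suc i ≤ᵇ a) ∧ (suc (a ℕ.+ b) ≤ᵇ suc j) ≡ true →
    ℕtoℚ (((suc j ∸ suc (a ℕ.+ b)) ℕ.* j ℕ.+ (suc j ∸ suc i)) ℕ.* (suc i ℕ.* prodMinus1 K))
      ≡ (((+ suc j ℤ.- + suc a ℤ.- + b) / 1) ℚ.+ frac (+ suc j ℤ.- + suc i) j) ℚ.* ℕtoℚ (wK (suc i ∷ suc j ∷ K))
  exceptional eq = trans
    (cK-exceptional (suc j ∸ suc (a ℕ.+ b)) j (suc j ∸ suc i) (suc i) (prodMinus1 K) (frac (+ suc j ℤ.- + suc i) j) frac≡)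
    (cong (λ z → ((z / 1) ℚ.+ frac (+ suc j ℤ.- + suc i) j) ℚ.* ℕtoℚ (wK (suc i ∷ suc j ∷ K))) diff≡)
    where
    i<a : suc i ℕ.≤ a
    i<a = ≤ᵇ-elim (∧-conicalˡ (suc i ≤ᵇ a) _ eq)
    t≤j : suc (a ℕ.+ b) ℕ.≤ suc j
    t≤j = ≤ᵇ-elim {suc (a ℕ.+ b)} (∧-conicalʳ (suc i ≤ᵇ a) _ eq)
    -- This says k₁ ≤ k₂ - 1, so the denominator of `frac` is positive and k₂ - k₁ is a natural
    -- number.
    i<j : suc i ℕ.≤ j
    i<j = ℕₚ.≤-trans i<a (ℕₚ.≤-trans (ℕₚ.m≤m+n a b) (ℕₚ.≤-pred t≤j))
    diff≡ : + (suc j ∸ suc (a ℕ.+ b)) ≡ + suc j ℤ.- + suc a ℤ.- + b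
    diff≡ = sym (trans (identity (+ suc j) (+ suc a) (+ b)) (pos-∸ t≤j))
      where
      identity : ∀ x y z → x ℤ.- y ℤ.- z ≡ x ℤ.- (y ℤ.+ z)
      identity = ℤ-Solver.solve-∀
    frac≡ : frac (+ suc j ℤ.- + suc i) j ℚ.* ℕtoℚ j ≡ ℕtoℚ (suc j ∸ suc i)
    frac≡ = trans (frac-cancel (+ suc j ℤ.- + suc i) (ℕₚ.≤-trans (s≤s z≤n) i<j)) (cong (_/ 1) (pos-∸ (ℕₚ.m≤n⇒m≤1+n i<j)))

module _ {c ℓ} (R : CommutativeRing c ℓ) {N : ℕ} (X : Fin N → CommutativeRing.Carrier R) where

  open CommutativeRing R using (_≈_; _*_; _+_; *-cong; *-congˡ; *-congʳ; *-assoc; *-commutativeSemigroup; +-group; +-commutativeMonoid; +-congˡ; +-congʳ; setoid)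
  private module R = CommutativeRing R
  open Transfer R X
  open Expansion R X
  open CompositionSum +-commutativeMonoid
  open import Algebra.Properties.Group +-group using () renaming (∙-cancelʳ to +-cancelʳ)
  open import Algebra.Properties.CommutativeSemigroup *-commutativeSemigroup using (x∙yz≈y∙xz)
  open SetoidReasoning setoid

  eProd-swapHead : ∀ K → eProd (swapHead K) ≈ eProd K
  eProd-swapHead []          = R.refl
  eProd-swapHead (_ ∷ [])    = R.refl
  eProd-swapHead (j ∷ k ∷ K) = x∙yz≈y∙xz (e k) (e j) (eProd K)

  -- The products e_K are symmetric in the first two parts, so `excess` may be summed at
  -- `swapHead K` before it is cancelled.
  L-coef : ∀ a b m → L a b m ≈ E[ coef (suc a) b ] (a ℕ.+ b ℕ.+ suc m)
  L-coef a b m = +-cancelʳ (E[ excess (suc a) t ] n) _ _ (begin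
    L a b m + E[ excess (suc a) t ] n
      ≈⟨ L-keepLarge a b m ⟩
    E[ keepLarge (suc a) t ] n
      ≈⟨ E-cong n (coef-excess a b) ⟨
    E[ (λ K → coef (suc a) b K ℕ.+ excess (suc a) t (swapHead K)) ] n
      ≈⟨ E-+ n (coef (suc a) b) (λ K → excess (suc a) t (swapHead K)) ⟩
    E[ coef (suc a) b ] n + E[ (λ K → excess (suc a) t (swapHead K)) ] n
      ≈⟨ +-congˡ (S-cong n (λ {K} _ → *-congˡ (R.sym (eProd-swapHead K)))) ⟩
    E[ coef (suc a) b ] n + S n (λ K → wt (excess (suc a) t) (swapHead K))
      ≈⟨ +-congˡ (S-swapHead n (wt (excess (suc a) t))) ⟨
    E[ coef (suc a) b ] n + E[ excess (suc a) t ] n ∎)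
    where
    n t : ℕ
    n = a ℕ.+ b ℕ.+ suc m
    t = suc (a ℕ.+ b)

-- Polynomials

open Antidiagonal ℚₚ.+-0-commutativeMonoid
open ListSum ℚₚ.+-0-commutativeMonoid
open CompositionSum ℚₚ.+-0-commutativeMonoid

infixl 6 _⊕_

_⊕_ : ∀ {N} → Poly N → Poly N → Poly N
(p ⊕ q) α = p α ℚ.+ q α

zeroP : ∀ {N} → Poly N
zeroP α = 0ℚ

infix 4 _≗ᴾ_
_≗ᴾ_ : ∀ {N} → Poly N → Poly N → Set
p ≗ᴾ q = ∀ α → p α ≡ q α

slice : ∀ {N} → ℕ → Poly (suc N) → Poly N
slice i p α = p (i ∷ α)

Σ-upTo : ∀ n h → Σ[ (λ i → h i (n ℕ.∸ i)) ] (upTo (suc n)) ≡ anti n h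
Σ-upTo n h = trans (cong Σℚ (map-applyUpTo id (λ i → h i (n ℕ.∸ i)) (suc n))) (go n h)
  where
  go : ∀ n h → Σℚ (applyUpTo (λ i → h i (n ℕ.∸ i)) (suc n)) ≡ anti n h
  go zero    h = ℚₚ.+-identityʳ _
  go (suc n) h = cong (h 0 (suc n) ℚ.+_) (go n (λ i r → h (suc i) r))

·-cong : ∀ {N} {p p′ q q′ : Poly N} → p ≗ᴾ p′ → q ≗ᴾ q′ → p · q ≗ᴾ p′ · q′
·-cong p≗ q≗ α = Σ-cong (λ β → cong₂ ℚ._*_ (p≗ β) (q≗ _)) (below α)

·-slice : ∀ {N} (p q : Poly (suc N)) a α → (p · q) (a ∷ α) ≡ anti a (λ i r → (slice i p · slice r q) α)
·-slice p q a α = begin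
  Σ[ F ] (concatMap (λ i → map (i ∷_) (below α)) (upTo (suc a)))
    ≡⟨ Σ-concatMap F (λ i → map (i ∷_) (below α)) (upTo (suc a)) ⟩
  Σ[ (λ i → Σ[ F ] (map (i ∷_) (below α))) ] (upTo (suc a))
    ≡⟨ Σ-cong (λ i → Σ-map F (i ∷_) (below α)) (upTo (suc a)) ⟩
  Σ[ (λ i → (slice i p · slice (a ℕ.∸ i) q) α) ] (upTo (suc a))
    ≡⟨ Σ-upTo a (λ i r → (slice i p · slice r q) α) ⟩
  anti a (λ i r → (slice i p · slice r q) α) ∎
  where
  open ≡-Reasoning
  F : Vec ℕ _ → ℚ
  F β = p β ℚ.* q (zipWith ℕ._∸_ (a ∷ α) β)

·-distribˡ : ∀ {N} (p q r : Poly N) → p · (q ⊕ r) ≗ᴾ (p · q) ⊕ (p · r)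
·-distribˡ p q r α = trans (Σ-cong (λ β → ℚₚ.*-distribˡ-+ (p β) _ _) (below α)) (Σ-∙ _ _ (below α))

·-zeroˡ : ∀ {N} (q : Poly N) → zeroP · q ≗ᴾ zeroP
·-zeroˡ q α = Σ-ε (λ β → ℚₚ.*-zeroˡ (q (zipWith ℕ._∸_ α β))) (below α)

·-comm : ∀ {N} (p q : Poly N) → p · q ≗ᴾ q · p
·-comm p q []      = cong (ℚ._+ 0ℚ) (ℚₚ.*-comm (p []) (q []))
·-comm p q (a ∷ α) = begin
  (p · q) (a ∷ α)                             ≡⟨ ·-slice p q a α ⟩
  anti a (λ i r → (slice i p · slice r q) α)  ≡⟨ anti-cong a (λ i r _ → ·-comm (slice i p) (slice r q) α) ⟩
  anti a (λ i r → (slice r q · slice i p) α)  ≡⟨ anti-flip a (λ i r → (slice r q · slice i p) α) ⟩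
  anti a (λ i r → (slice i q · slice r p) α)  ≡⟨ ·-slice q p a α ⟨
  (q · p) (a ∷ α)                             ∎
  where open ≡-Reasoning

·-anti : ∀ {N} (p : Poly N) a (h : ℕ → ℕ → Poly N) → p · (λ α → anti a (λ i r → h i r α)) ≗ᴾ (λ α → anti a (λ i r → (p · h i r) α))
·-anti p zero    h α = refl
·-anti p (suc a) h α = trans (·-distribˡ p (h 0 (suc a)) (λ β → anti a (λ i r → h (suc i) r β)) α) (cong ((p · h 0 (suc a)) α ℚ.+_) (·-anti p a (λ i r → h (suc i) r) α))

-- Slicing in the first variable turns both sides into sums over i + j + s = a, and `anti-swap`
-- exchanges i and j. Together with commutativity this yields associativity.
·-swap : ∀ {N} (p q r : Poly N) → p · (q · r) ≗ᴾ q · (p · r)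
·-swap p q r [] = begin
  p [] ℚ.* (q [] ℚ.* r [] ℚ.+ 0ℚ) ℚ.+ 0ℚ  ≡⟨ cong (λ z → p [] ℚ.* z ℚ.+ 0ℚ) (ℚₚ.+-identityʳ _) ⟩
  p [] ℚ.* (q [] ℚ.* r []) ℚ.+ 0ℚ         ≡⟨ cong (ℚ._+ 0ℚ) (x∙yz≈y∙xz (p []) (q []) (r [])) ⟩
  q [] ℚ.* (p [] ℚ.* r []) ℚ.+ 0ℚ         ≡⟨ cong (λ z → q [] ℚ.* z ℚ.+ 0ℚ) (ℚₚ.+-identityʳ _) ⟨
  q [] ℚ.* (p [] ℚ.* r [] ℚ.+ 0ℚ) ℚ.+ 0ℚ  ∎
  where
  open ≡-Reasoning
  open import Algebra.Properties.CommutativeSemigroup (CommutativeMonoid.commutativeSemigroup ℚₚ.*-1-commutativeMonoid) using (x∙yz≈y∙xz)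
·-swap {suc N} p q r (a ∷ α) = begin
  (p · (q · r)) (a ∷ α)
    ≡⟨ expand p q r ⟩
  anti a (λ i t → anti t (λ j s → (slice i p · (slice j q · slice s r)) α))
    ≡⟨ anti-swap a (λ i j s → (slice i p · (slice j q · slice s r)) α) ⟩
  anti a (λ j t → anti t (λ i s → (slice i p · (slice j q · slice s r)) α))
    ≡⟨ anti-cong a (λ j t _ → anti-cong t (λ i s _ → ·-swap (slice i p) (slice j q) (slice s r) α)) ⟩
  anti a (λ j t → anti t (λ i s → (slice j q · (slice i p · slice s r)) α))
    ≡⟨ expand q p r ⟨
  (q · (p · r)) (a ∷ α) ∎
  where
  open ≡-Reasoning
  expand : ∀ (p q r : Poly (suc N)) →
           (p · (q · r)) (a ∷ α) ≡ anti a (λ i t → anti t (λ j s → (slice i p · (slice j q · slice s r)) α))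
  expand p q r = trans (·-slice p (q · r) a α) (anti-cong a (λ i t _ →
    trans (·-cong {p = slice i p} (λ _ → refl) (·-slice q r t) α) (·-anti (slice i p) t (λ j s → slice j q · slice s r) α)))

·-identityˡ : ∀ {N} (q : Poly N) → oneP · q ≗ᴾ q
·-identityˡ q []      = trans (ℚₚ.+-identityʳ _) (ℚₚ.*-identityˡ _)
·-identityˡ q (a ∷ α) = begin
  (oneP · q) (a ∷ α)                             ≡⟨ ·-slice oneP q a α ⟩
  anti a (λ i r → (slice i oneP · slice r q) α)  ≡⟨ anti-pick 0 a _ off ⟩
  (oneP · slice a q) α                           ≡⟨ ·-identityˡ (slice a q) α ⟩
  q (a ∷ α)                                      ∎
  where
  open ≡-Reasoning
  off : ∀ i r → i ≢ 0 → (slice i oneP · slice r q) α ≡ 0ℚ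
  off zero    r i≢0 with () ← i≢0 refl
  off (suc i) r _   = ·-zeroˡ (slice r q) α

·-assoc : ∀ {N} (p q r : Poly N) → (p · q) · r ≗ᴾ p · (q · r)
·-assoc p q r α = begin
  ((p · q) · r) α  ≡⟨ ·-comm (p · q) r α ⟩
  (r · (p · q)) α  ≡⟨ ·-swap r p q α ⟩
  (p · (r · q)) α  ≡⟨ ·-cong {p = p} (λ _ → refl) (·-comm r q) α ⟩
  (p · (q · r)) α  ∎
  where open ≡-Reasoning

polyRing : ℕ → CommutativeRing 0ℓ 0ℓ
polyRing N = record
  { Carrier = Poly N
  ; _≈_ = _≗ᴾ_
  ; _+_ = _⊕_
  ; _*_ = _·_
  ; -_ = λ p α → ℚ.- p α
  ; 0# = zeroP
  ; 1# = oneP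
  ; isCommutativeRing = record
    { isRing = record
      { +-isAbelianGroup = record
        { isGroup = record
          { isMonoid = record
            { isSemigroup = record
              { isMagma = record
                { isEquivalence = record
                  { refl = λ α → refl
                  ; sym = λ p α → sym (p α)
                  ; trans = λ p q α → trans (p α) (q α)
                  }
                ; ∙-cong = λ p q α → cong₂ ℚ._+_ (p α) (q α)
                }
              ; assoc = λ p q r α → ℚₚ.+-assoc (p α) (q α) (r α)
              }
            ; identity = (λ p α → ℚₚ.+-identityˡ (p α)) , (λ p α → ℚₚ.+-identityʳ (p α))
            }
          ; inverse = (λ p α → ℚₚ.+-inverseˡ (p α)) , (λ p α → ℚₚ.+-inverseʳ (p α))
          ; ⁻¹-cong = λ p α → cong ℚ.-_ (p α)
          }
        ; comm = λ p q α → ℚₚ.+-comm (p α) (q α)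
        }
      ; *-cong = λ {p} {p′} {q} {q′} → ·-cong {p = p} {p′} {q} {q′}
      ; *-assoc = ·-assoc
      ; *-identity = ·-identityˡ , (λ p α → trans (·-comm p oneP α) (·-identityˡ p α))
      ; distrib = ·-distribˡ , (λ r p q α → trans (·-comm (p ⊕ q) r α)
          (trans (·-distribˡ r p q α) (cong₂ ℚ._+_ (·-comm r p α) (·-comm r q α))))
      }
    ; *-comm = ·-comm
    }
  }

lift : ∀ {N} → Poly N → Poly (suc N)
lift p (zero  ∷ α) = p α
lift p (suc a ∷ α) = 0ℚ

var : ∀ {N} → Fin N → Poly N
var zero    (suc zero    ∷ α) = oneP α
var zero    (zero        ∷ α) = 0ℚ
var zero    (suc (suc a) ∷ α) = 0ℚ
var (suc x)                   = lift (var x)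

lift-·-slice : ∀ {N} (p : Poly N) q a α → (lift p · q) (a ∷ α) ≡ (p · slice a q) α
lift-·-slice p q a α = trans (·-slice (lift p) q a α) (anti-pick 0 a _ off)
  where
  off : ∀ i r → i ≢ 0 → (slice i (lift p) · slice r q) α ≡ 0ℚ
  off zero    r i≢0 = contradiction refl i≢0
  off (suc i) r _   = ·-zeroˡ (slice r q) α

var-zero-·-zero : ∀ {N} (p : Poly (suc N)) α → (var zero · p) (0 ∷ α) ≡ 0ℚ
var-zero-·-zero p α = trans (·-slice (var zero) p 0 α) (·-zeroˡ (slice 0 p) α)

var-zero-·-suc : ∀ {N} (p : Poly (suc N)) a α → (var zero · p) (suc a ∷ α) ≡ p (a ∷ α)
var-zero-·-suc p a α = trans (·-slice (var zero) p (suc a) α) (trans (anti-pick 1 a _ off) (·-identityˡ (slice a p) α))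
  where
  off : ∀ i r → i ≢ 1 → (slice i (var zero) · slice r p) α ≡ 0ℚ
  off zero          r _   = ·-zeroˡ (slice r p) α
  off (suc zero)    r i≢1 = contradiction refl i≢1
  off (suc (suc i)) r _   = ·-zeroˡ (slice r p) α

lift-⊕ : ∀ {N} (p q : Poly N) → lift (p ⊕ q) ≗ᴾ lift p ⊕ lift q
lift-⊕ p q (zero  ∷ α) = refl
lift-⊕ p q (suc a ∷ α) = refl

lift-· : ∀ {N} (p q : Poly N) → lift (p · q) ≗ᴾ lift p · lift q
lift-· p q (zero  ∷ α) = sym (lift-·-slice p (lift q) 0 α)
lift-· p q (suc a ∷ α) = sym (trans (lift-·-slice p (lift q) (suc a) α) (trans (·-comm p zeroP α) (·-zeroˡ p α)))

elemP : ∀ {N M} → ℕ → (Fin M → Poly N) → Poly N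
elemP {N} = Elementary.elem (polyRing N)

elem-lift : ∀ {N M} k (v : Fin M → Poly N) → elemP k (lift ∘ v) ≗ᴾ lift (elemP k v)
elem-lift         zero    v (zero  ∷ α) = refl
elem-lift         zero    v (suc a ∷ α) = refl
elem-lift {M = zero}  (suc k) v (zero  ∷ α) = refl
elem-lift {M = zero}  (suc k) v (suc a ∷ α) = refl
elem-lift {M = suc M} (suc k) v α = begin
  elemP (suc k) (lift ∘ v ∘ suc) α ℚ.+ (lift (v zero) · elemP k (lift ∘ v ∘ suc)) α
    ≡⟨ cong₂ ℚ._+_ (elem-lift (suc k) (v ∘ suc) α) (·-cong {p = lift (v zero)} (λ _ → refl) (elem-lift k (v ∘ suc)) α) ⟩
  lift (elemP (suc k) (v ∘ suc)) α ℚ.+ (lift (v zero) · lift (elemP k (v ∘ suc))) α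
    ≡⟨ cong (lift (elemP (suc k) (v ∘ suc)) α ℚ.+_) (lift-· (v zero) (elemP k (v ∘ suc)) α) ⟨
  lift (elemP (suc k) (v ∘ suc)) α ℚ.+ lift (v zero · elemP k (v ∘ suc)) α
    ≡⟨ lift-⊕ (elemP (suc k) (v ∘ suc)) (v zero · elemP k (v ∘ suc)) α ⟨
  lift (elemP (suc k) v) α ∎
  where open ≡-Reasoning

eP-zero : ∀ {N} → eP 0 ≗ᴾ oneP {N}
eP-zero []                = refl
eP-zero (zero        ∷ α) = eP-zero α
eP-zero (suc zero    ∷ α) = cong (if_then 1ℚ else 0ℚ) (∧-zeroʳ (allᵇ (λ x → x ≤ᵇ 1) (V.toList α)))
eP-zero (suc (suc a) ∷ α) = refl

elem-var : ∀ {N} k → elemP k (var {N}) ≗ᴾ eP k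
elem-var         zero    α  = sym (eP-zero α)
elem-var {zero}  (suc k) [] = refl
elem-var {suc N} (suc k) (a ∷ α) = trans
  (cong₂ ℚ._+_ (elem-lift (suc k) var (a ∷ α)) (·-cong {p = var zero} (λ _ → refl) (elem-lift k var) (a ∷ α)))
  (go a)
  where
  go : ∀ a → lift (elemP (suc k) var) (a ∷ α) ℚ.+ (var zero · lift (elemP k var)) (a ∷ α) ≡ eP (suc k) (a ∷ α)
  go zero          = trans (cong₂ ℚ._+_ (elem-var (suc k) α) (var-zero-·-zero (lift (elemP k var)) α)) (ℚₚ.+-identityʳ _)
  go (suc zero)    = trans (ℚₚ.+-identityˡ _) (trans (var-zero-·-suc (lift (elemP k var)) 0 α) (elem-var k α))
  go (suc (suc a)) = trans (ℚₚ.+-identityˡ _) (var-zero-·-suc (lift (elemP k var)) (suc a) α)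

-- Counting colourings by content

bump : ∀ {N} → Fin N → Vec ℕ N → Vec ℕ N
bump x α = updateAt α x suc

-- Multiplication by a variable shifts exponents: the coefficient at α is 0 in the first case and
-- comes from β in the second.
bump-view : ∀ {N} (x : Fin N) α → lookup α x ≡ 0 ⊎ ∃ λ β → α ≡ bump x β
bump-view zero    (zero  ∷ α) = inj₁ refl
bump-view zero    (suc a ∷ α) = inj₂ (a ∷ α , refl)
bump-view (suc x) (a ∷ α) with bump-view x α
... | inj₁ eq         = inj₁ eq
... | inj₂ (β , refl) = inj₂ (a ∷ β , refl)

var-·-bump : ∀ {N} (x : Fin N) p β → (var x · p) (bump x β) ≡ p β
var-·-bump zero    p (b ∷ β) = var-zero-·-suc p b β
var-·-bump (suc x) p (b ∷ β) = trans (lift-·-slice (var x) p b (bump x β)) (var-·-bump x (slice b p) β)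

var-·-zero : ∀ {N} (x : Fin N) p α → lookup α x ≡ 0 → (var x · p) α ≡ 0ℚ
var-·-zero zero    p (zero ∷ α) _  = var-zero-·-zero p α
var-·-zero (suc x) p (a ∷ α)    eq = trans (lift-·-slice (var x) p a α) (var-·-zero x (slice a p) α eq)

eqVecᵇ-bump : ∀ {N} (x : Fin N) β γ → eqVecᵇ (bump x β) (bump x γ) ≡ eqVecᵇ β γ
eqVecᵇ-bump zero    (b ∷ β) (c ∷ γ) = refl
eqVecᵇ-bump (suc x) (b ∷ β) (c ∷ γ) = cong ((b ≡ᵇ c) ∧_) (eqVecᵇ-bump x β γ)

eqVecᵇ-bump-zero : ∀ {N} (x : Fin N) β α → lookup α x ≡ 0 → eqVecᵇ (bump x β) α ≡ false
eqVecᵇ-bump-zero zero    (b ∷ β) (zero ∷ α) _  = refl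
eqVecᵇ-bump-zero (suc x) (b ∷ β) (a ∷ α)    eq = trans (cong ((b ≡ᵇ a) ∧_) (eqVecᵇ-bump-zero x β α eq)) (∧-zeroʳ (b ≡ᵇ a))

content-∷ : ∀ {N n} (x : Fin N) (κ : Vec (Fin N) n) → content (x ∷ κ) ≡ bump x (content κ)
content-∷ x κ = go x (λ c i → c ≡ᵇ toℕ i) (λ i → refl)
  where
  -- The comparison is abstracted to P because past the head of the vector position i is compared as
  -- `suc i`, which no longer has the form of the test in `content`.
  go : ∀ {M} (y : Fin M) (P : ℕ → Fin M → Bool) → (∀ i → P (toℕ x) i ≡ (toℕ y ≡ᵇ toℕ i)) →
       V.tabulate (λ i → length (filterᵇ (λ c → P (toℕ c) i) (V.toList (x ∷ κ))))
         ≡ bump y (V.tabulate (λ i → length (filterᵇ (λ c → P (toℕ c) i) (V.toList κ))))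
  go {suc M} zero P eq = cong₂ _∷_ head≡ (tabulate-cong rest≡)
    where
    head≡ : length (filterᵇ (λ c → P (toℕ c) zero) (x ∷ V.toList κ)) ≡ suc (length (filterᵇ (λ c → P (toℕ c) zero) (V.toList κ)))
    head≡ rewrite eq zero = refl
    rest≡ : ∀ i → length (filterᵇ (λ c → P (toℕ c) (suc i)) (x ∷ V.toList κ)) ≡ length (filterᵇ (λ c → P (toℕ c) (suc i)) (V.toList κ))
    rest≡ i rewrite eq (suc i) = refl
  go {suc M} (suc y) P eq = cong₂ _∷_ head≡ (go y (λ c i → P c (suc i)) (λ i → eq (suc i)))
    where
    head≡ : length (filterᵇ (λ c → P (toℕ c) zero) (x ∷ V.toList κ)) ≡ length (filterᵇ (λ c → P (toℕ c) zero) (V.toList κ))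
    head≡ rewrite eq zero = refl

ind : Bool → ℚ
ind b = if b then 1ℚ else 0ℚ

length-filterᵇ : ∀ {A : Set} (p : A → Bool) xs → ℕtoℚ (length (filterᵇ p xs)) ≡ Σ[ (λ x → ind (p x)) ] xs
length-filterᵇ p []       = refl
length-filterᵇ p (x ∷ xs) with p x
... | true  = trans (ℕtoℚ-+ 1 (length (filterᵇ p xs))) (cong (1ℚ ℚ.+_) (length-filterᵇ p xs))
... | false = trans (length-filterᵇ p xs) (sym (ℚₚ.+-identityˡ _))

Σ-tabulate : ∀ {A : Set} (f : A → ℚ) n (g : Fin n → A) (h : Fin n → ℚ) → (∀ x → f (g x) ≡ h x) → Σ[ f ] (tabulate g) ≡ Σ[ h ] (allFin n)
Σ-tabulate f zero    g h eq = refl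
Σ-tabulate f (suc n) g h eq = cong₂ ℚ._+_ (eq zero) (trans (Σ-tabulate f n (g ∘ suc) (h ∘ suc) (eq ∘ suc)) (sym (Σ-tabulate h n suc (h ∘ suc) (λ _ → refl))))

module _ (N : ℕ) where

  open import Algebra.Properties.Semiring.Sum (CommutativeRing.semiring (polyRing N)) using (sum)
  open Colorings (polyRing N) var
  open Scalars (polyRing N)
  open Transfer (polyRing N) var using (L; D; pow)
  open Elementary (polyRing N) using (⟨_,_⟩)
  open Expansion (polyRing N) var using (eProd; wt; E[_])
  open ListSum (CommutativeRing.+-commutativeMonoid (polyRing N)) using () renaming (Σ[_] to Σᴾ[_])

  sum-apply : ∀ n (h : Fin n → Poly N) α → sum h α ≡ Σ[ (λ x → h x α) ] (allFin n)
  sum-apply zero    h α = refl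
  sum-apply (suc n) h α = cong (h zero α ℚ.+_) (trans (sum-apply n (h ∘ suc) α) (sym (Σ-tabulate (λ x → h x α) n suc (λ x → h (suc x) α) (λ _ → refl))))

  Σᴾ-apply : ∀ {A : Set} (f : A → Poly N) xs α → Σᴾ[ f ] xs α ≡ Σ[ (λ x → f x α) ] xs
  Σᴾ-apply f []       α = refl
  Σᴾ-apply f (x ∷ xs) α = cong (f x α ℚ.+_) (Σᴾ-apply f xs α)

  ι-·-apply : ∀ m p α → (ι m · p) α ≡ ℕtoℚ m ℚ.* p α
  ι-·-apply zero    p α = trans (·-zeroˡ p α) (sym (ℚₚ.*-zeroˡ (p α)))
  ι-·-apply (suc m) p α = begin
    ((oneP ⊕ ι m) · p) α                ≡⟨ CommutativeRing.distribʳ (polyRing N) p oneP (ι m) α ⟩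
    (oneP · p) α ℚ.+ (ι m · p) α        ≡⟨ cong₂ ℚ._+_ (trans (·-identityˡ p α) (sym (ℚₚ.*-identityˡ (p α)))) (ι-·-apply m p α) ⟩
    1ℚ ℚ.* p α ℚ.+ ℕtoℚ m ℚ.* p α       ≡⟨ ℚₚ.*-distribʳ-+ (p α) 1ℚ (ℕtoℚ m) ⟨
    (1ℚ ℚ.+ ℕtoℚ m) ℚ.* p α             ≡⟨ cong (ℚ._* p α) (ℕtoℚ-+ 1 m) ⟨
    ℕtoℚ (suc m) ℚ.* p α                ∎
    where open ≡-Reasoning

  eProd-eComp : ∀ K → eProd K ≗ᴾ eComp K
  eProd-eComp []      α = refl
  eProd-eComp (k ∷ K) α = ·-cong {p = elemP k var} {eP k} (elem-var k) (eProd-eComp K) α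

  eqVecᵇ-content-[] : ∀ (φ : Bool) α → ind (φ ∧ eqVecᵇ (content {N} []) α) ≡ (if φ then oneP else zeroP {N}) α
  eqVecᵇ-content-[] true  α = cong ind (go (λ _ → 0) (λ _ → refl) α)
    where
    go : ∀ {M} (f : Fin M → ℕ) → (∀ i → f i ≡ 0) → ∀ α → eqVecᵇ (V.tabulate f) α ≡ allᵇ (λ x → x ≡ᵇ 0) (V.toList α)
    go f f≡0 []      = refl
    go f f≡0 (a ∷ α) rewrite f≡0 zero = cong₂ _∧_ (≡ᵇ-sym 0 a) (go (f ∘ suc) (f≡0 ∘ suc) α)
  eqVecᵇ-content-[] false α = refl

  -- Colouring the first vertex with x bumps the content at x, and its weight `var x` shifts
  -- exponents in the same way. So `colSum` over the variables is the generating function of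
  -- contents.
  count-colSum : ∀ v n (φ : Vec (Fin N) n → Bool) α →
    Σ[ (λ κ → ind (φ κ ∧ eqVecᵇ (content κ) α)) ] (allMaps N n) ≡ colSum v 0 n φ α
  count-colSum v zero    φ α = trans (ℚₚ.+-identityʳ _) (eqVecᵇ-content-[] (φ []) α)
  count-colSum v (suc n) φ α = begin
    Σ[ F ] (concatMap (λ x → map (x ∷_) (allMaps N n)) (allFin N))
      ≡⟨ Σ-concatMap F (λ x → map (x ∷_) (allMaps N n)) (allFin N) ⟩
    Σ[ (λ x → Σ[ F ] (map (x ∷_) (allMaps N n))) ] (allFin N)
      ≡⟨ Σ-cong (λ x → trans (Σ-map F (x ∷_) (allMaps N n)) (peel x)) (allFin N) ⟩
    Σ[ (λ x → (var x · G x) α) ] (allFin N)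
      ≡⟨ sum-apply N (λ x → var x · G x) α ⟨
    sum (λ x → var x · G x) α ∎
    where
    open ≡-Reasoning
    F : Vec (Fin N) (suc n) → ℚ
    F κ = ind (φ κ ∧ eqVecᵇ (content κ) α)
    G : Fin N → Poly N
    G x = colSum v 0 n (λ κ → φ (x ∷ κ))
    peel : ∀ x → Σ[ (λ κ → F (x ∷ κ)) ] (allMaps N n) ≡ (var x · G x) α
    peel x with bump-view x α
    ... | inj₁ αx≡0 = trans
      (Σ-ε (λ κ → cong ind (trans (cong (φ (x ∷ κ) ∧_) (trans (cong (λ γ → eqVecᵇ γ α) (content-∷ x κ)) (eqVecᵇ-bump-zero x (content κ) α αx≡0))) (∧-zeroʳ (φ (x ∷ κ))))) (allMaps N n))
      (sym (var-·-zero x (G x) α αx≡0))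
    ... | inj₂ (β , refl) = begin
      Σ[ (λ κ → ind (φ (x ∷ κ) ∧ eqVecᵇ (content (x ∷ κ)) (bump x β))) ] (allMaps N n)
        ≡⟨ Σ-cong (λ κ → cong (λ b → ind (φ (x ∷ κ) ∧ b)) (trans (cong (λ γ → eqVecᵇ γ (bump x β)) (content-∷ x κ)) (eqVecᵇ-bump x (content κ) β))) (allMaps N n) ⟩
      Σ[ (λ κ → ind (φ (x ∷ κ) ∧ eqVecᵇ (content κ) β)) ] (allMaps N n)
        ≡⟨ count-colSum v n (λ κ → φ (x ∷ κ)) β ⟩
      G x β
        ≡⟨ var-·-bump x (G x) β ⟨
      (var x · G x) (bump x β) ∎

  XG-coef : ∀ a b m α → let n = a ℕ.+ b ℕ.+ suc (suc m) in
    XG (suc a) b (suc (suc m)) N α ≡ ℕtoℚ (a !) ℚ.* Σ[ (λ K → ℕtoℚ (coef (suc a) b K) ℚ.* eComp K α) ] (comps n)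
  XG-coef a b m α = begin
    XG (suc a) b (suc (suc m)) N α
      ≡⟨ length-filterᵇ (λ κ → properᵇ (suc a) b (suc (suc m)) κ ∧ eqVecᵇ (content κ) α) (allMaps N n) ⟩
    Σ[ (λ κ → ind (properᵇ (suc a) b (suc (suc m)) κ ∧ eqVecᵇ (content κ) α)) ] (allMaps N n)
      ≡⟨ Σ-cong (λ κ → cong (λ b → ind (b ∧ eqVecᵇ (content κ) α)) (properᵇ≡properRec (suc a) b (suc (suc m)) κ)) (allMaps N n) ⟩
    Σ[ (λ κ → ind (proper κ ∧ eqVecᵇ (content κ) α)) ] (allMaps N n)
      ≡⟨ count-colSum var n proper α ⟩
    colSum var 0 n proper α
      ≡⟨ colSum-uniform var (suc a) n proper α ⟩
    colSum var (suc a) n proper α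
      ≡⟨ colSum-graph a b m var α ⟩
    (ι (a !) · L a b (suc m)) α
      ≡⟨ ι-·-apply (a !) (L a b (suc m)) α ⟩
    ℕtoℚ (a !) ℚ.* L a b (suc m) α
      ≡⟨ cong (ℕtoℚ (a !) ℚ.*_) (L-coef (polyRing N) var a b (suc m) α) ⟩
    ℕtoℚ (a !) ℚ.* E[ coef (suc a) b ] n α
      ≡⟨ cong (ℕtoℚ (a !) ℚ.*_) (trans (Σᴾ-apply (wt (coef (suc a) b)) (comps n) α)
           (Σ-cong (λ K → trans (ι-·-apply (coef (suc a) b K) (eProd K) α) (cong (ℕtoℚ (coef (suc a) b K) ℚ.*_) (eProd-eComp K α))) (comps n))) ⟩
    ℕtoℚ (a !) ℚ.* Σ[ (λ K → ℕtoℚ (coef (suc a) b K) ℚ.* eComp K α) ] (comps n) ∎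
    where
    open ≡-Reasoning
    n : ℕ
    n = a ℕ.+ b ℕ.+ suc (suc m)
    proper : Vec (Fin N) n → Bool
    proper = properRec (edgeᵇ (suc a) b (suc (suc m)))

-- Collecting compositions into partitions

IsComp-↭ : ∀ {n K J} → K ↭ J → IsComp n K → IsComp n J
IsComp-↭ ↭.refl         c           = c
IsComp-↭ (↭.prep _ p)   (i ∷ c)     = i ∷ IsComp-↭ p c
IsComp-↭ (↭.swap {ys = J} _ _ p) (_∷_ i (_∷_ j {r} c)) = ≡.subst (λ n → IsComp n (suc j ∷ suc i ∷ J)) (x∙yz≈y∙xz (suc j) (suc i) r) (j ∷ (i ∷ IsComp-↭ p c))
  where open import Algebra.Properties.CommutativeSemigroup ℕₚ.+-commutativeSemigroup using (x∙yz≈y∙xz)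
IsComp-↭ (↭.trans p q)  c           = IsComp-↭ q (IsComp-↭ p c)

eComp-↭ : ∀ {N K J} → K ↭ J → eComp {N} K ≗ᴾ eComp J
eComp-↭ ↭.refl         α = refl
eComp-↭ (↭.prep k p)   α = ·-cong {p = eP k} (λ _ → refl) (eComp-↭ p) α
eComp-↭ (↭.swap {xs = K} {ys = J} j k p) α = trans (·-swap (eP j) (eP k) (eComp K) α)
  (·-cong {p = eP k} (λ _ → refl) (·-cong {p = eP j} (λ _ → refl) (eComp-↭ p)) α)
eComp-↭ (↭.trans p q)  α = trans (eComp-↭ p α) (eComp-↭ q α)

decreasingᵇ-true : ∀ {K} → Linked (λ x y → y ℕ.≤ x) K → decreasingᵇ K ≡ true
decreasingᵇ-true []           = refl
decreasingᵇ-true [-]          = refl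
decreasingᵇ-true (y≤x ∷ rest) rewrite ≤ᵇ-true y≤x = decreasingᵇ-true rest

Σ-filterᵇ : ∀ {A : Set} (f : A → ℚ) p xs → Σ[ f ] (filterᵇ p xs) ≡ Σ[ (λ x → if p x then f x else 0ℚ) ] xs
Σ-filterᵇ f p []       = refl
Σ-filterᵇ f p (x ∷ xs) with p x
... | true  = cong (f x ℚ.+_) (Σ-filterᵇ f p xs)
... | false = trans (Σ-filterᵇ f p xs) (sym (ℚₚ.+-identityˡ _))

Σ-comm : ∀ {A B : Set} (f : A → B → ℚ) xs ys → Σ[ (λ x → Σ[ f x ] ys) ] xs ≡ Σ[ (λ y → Σ[ (λ x → f x y) ] xs) ] ys
Σ-comm f []       ys = sym (Σ-ε (λ _ → refl) ys)
Σ-comm f (x ∷ xs) ys = trans (cong (Σ[ f x ] ys ℚ.+_) (Σ-comm f xs ys)) (sym (Σ-∙ (f x) (λ y → Σ[ (λ x → f x y) ] xs) ys))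

Σ-nonNeg : ∀ {A : Set} {f : A → ℚ} → (∀ x → 0ℚ ℚ.≤ f x) → ∀ xs → 0ℚ ℚ.≤ Σ[ f ] xs
Σ-nonNeg f≥0 []       = ℚₚ.≤-refl
Σ-nonNeg f≥0 (x ∷ xs) = ℚₚ.+-mono-≤ (f≥0 x) (Σ-nonNeg f≥0 xs)

collect : ℕ → (List ℕ → ℚ) → List ℕ → ℚ
collect n q μ = S n (λ K → if does (μ ≟ᴸ sort K) then q K else 0ℚ)

collect-nonNeg : ∀ n {q} → (∀ K → 0ℚ ℚ.≤ q K) → ∀ μ → 0ℚ ℚ.≤ collect n q μ
collect-nonNeg n {q} q≥0 μ = Σ-nonNeg nonNeg (comps n)
  where
  nonNeg : ∀ K → 0ℚ ℚ.≤ (if does (μ ≟ᴸ sort K) then q K else 0ℚ)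
  nonNeg K with does (μ ≟ᴸ sort K)
  ... | true  = q≥0 K
  ... | false = ℚₚ.≤-refl

-- After the two sums are exchanged, each K meets the single partition `sort K`, which is decreasing
-- because the order is flipped, and e_K depends only on the multiset of parts.
Σ-collect : ∀ {N} n q (α : Vec ℕ N) →
  Σ[ (λ μ → collect n q μ ℚ.* eComp μ α) ] (partitions n) ≡ S n (λ K → q K ℚ.* eComp K α)
Σ-collect n q α = begin
  Σ[ (λ μ → collect n q μ ℚ.* eComp μ α) ] (filterᵇ decreasingᵇ (comps n))
    ≡⟨ Σ-filterᵇ _ decreasingᵇ (comps n) ⟩
  S n (λ μ → if decreasingᵇ μ then collect n q μ ℚ.* eComp μ α else 0ℚ)
    ≡⟨ Σ-cong expand (comps n) ⟩
  S n (λ μ → S n (λ K → if does (μ ≟ᴸ sort K) then g K μ else 0ℚ))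
    ≡⟨ Σ-comm (λ μ K → if does (μ ≟ᴸ sort K) then g K μ else 0ℚ) (comps n) (comps n) ⟩
  S n (λ K → S n (λ μ → if does (μ ≟ᴸ sort K) then g K μ else 0ℚ))
    ≡⟨ S-cong n (λ {K} c → trans (S-pick (IsComp-↭ (↭.↭-sym (sort-↭ K)) c) (g K)) (g-sort K)) ⟩
  S n (λ K → q K ℚ.* eComp K α) ∎
  where
  open ≡-Reasoning
  -- Keeping the test inside `g` lets μ range over all compositions, where `S-pick` applies.
  g : List ℕ → List ℕ → ℚ
  g K μ = if decreasingᵇ μ then q K ℚ.* eComp μ α else 0ℚ
  g-sort : ∀ K → g K (sort K) ≡ q K ℚ.* eComp K α
  g-sort K rewrite decreasingᵇ-true (sort-↗ K) = cong (q K ℚ.*_) (eComp-↭ (sort-↭ K) α)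
  expand : ∀ μ → (if decreasingᵇ μ then collect n q μ ℚ.* eComp μ α else 0ℚ) ≡ S n (λ K → if does (μ ≟ᴸ sort K) then g K μ else 0ℚ)
  expand μ with decreasingᵇ μ
  ... | true  = trans (Σ-homo (ℚ._* eComp μ α) (ℚₚ.*-zeroˡ (eComp μ α)) (ℚₚ.*-distribʳ-+ (eComp μ α)) (λ K → if does (μ ≟ᴸ sort K) then q K else 0ℚ) (comps n))
                  (Σ-cong pull (comps n))
    where
    pull : ∀ K → (if does (μ ≟ᴸ sort K) then q K else 0ℚ) ℚ.* eComp μ α ≡ (if does (μ ≟ᴸ sort K) then q K ℚ.* eComp μ α else 0ℚ)
    pull K with does (μ ≟ᴸ sort K)
    ... | true  = refl
    ... | false = ℚₚ.*-zeroˡ (eComp μ α)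
  ... | false = sym (Σ-ε zeros (comps n))
    where
    zeros : ∀ K → (if does (μ ≟ᴸ sort K) then 0ℚ else 0ℚ) ≡ 0ℚ
    zeros K with does (μ ≟ᴸ sort K)
    ... | true  = refl
    ... | false = refl

theorem3p3 : (a b c : ℕ) → 1 ≤ a → 2 ≤ c →
    -- X_G = (a-1)! Σ_{K ⊨ n} c_K w_K e_K  (equality in every number N of variables)
    ((N : ℕ) (α : Vec ℕ N) →
      XG a b c N α ≡ ℕtoℚ ((a ∸ 1) !) ℚ.* Σℚ (map (λ K → cK a b K ℚ.* ℕtoℚ (wK K) ℚ.* eComp K α) (comps (nVert a b c))))
    -- positivity: c_K w_K ≥ 0 for every K ⊨ n
    × ((K : List ℕ) → K ∈ comps (nVert a b c) → 0ℚ ℚ.≤ cK a b K ℚ.* ℕtoℚ (wK K))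
    -- consequence: X_G is e-positive
    × Σ (List ℕ → ℚ) (λ d →
        ((μ : List ℕ) → μ ∈ partitions (nVert a b c) → 0ℚ ℚ.≤ d μ)
        × ((N : ℕ) (α : Vec ℕ N) → XG a b c N α ≡ Σℚ (map (λ μ → d μ ℚ.* eComp μ α) (partitions (nVert a b c)))))
theorem3p3 (suc a) b (suc (suc m)) _ (s≤s (s≤s _)) = expansion , positivity , collect n q , (λ μ _ → collect-nonNeg n q≥0 μ) , grouped
  where
  n : ℕ
  n = a ℕ.+ b ℕ.+ suc (suc m)
  expansion : ∀ N (α : Vec ℕ N) →
    XG (suc a) b (suc (suc m)) N α ≡ ℕtoℚ (a !) ℚ.* Σ[ (λ K → cK (suc a) b K ℚ.* ℕtoℚ (wK K) ℚ.* eComp K α) ] (comps n)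
  expansion N α = trans (XG-coef N a b m α)
    (cong (ℕtoℚ (a !) ℚ.*_) (S-cong n (λ {K} c → cong (ℚ._* eComp K α) (coef≡cK*wK a b c))))
  positivity : ∀ K → K ∈ comps n → 0ℚ ℚ.≤ cK (suc a) b K ℚ.* ℕtoℚ (wK K)
  positivity K K∈ = ≡.subst (0ℚ ℚ.≤_) (coef≡cK*wK a b (All.lookup (comps-IsComp n) K∈)) (ℕtoℚ-nonNeg (coef (suc a) b K))
  -- The factorial is absorbed into the natural coefficients, so that nonnegativity passes to the
  -- sum collected at each partition.
  q : List ℕ → ℚ
  q K = ℕtoℚ (a ! ℕ.* coef (suc a) b K)
  q≥0 : ∀ K → 0ℚ ℚ.≤ q K
  q≥0 K = ℕtoℚ-nonNeg (a ! ℕ.* coef (suc a) b K)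
  grouped : ∀ N (α : Vec ℕ N) → XG (suc a) b (suc (suc m)) N α ≡ Σ[ (λ μ → collect n q μ ℚ.* eComp μ α) ] (partitions n)
  grouped N α = begin
    XG (suc a) b (suc (suc m)) N α
      ≡⟨ XG-coef N a b m α ⟩
    ℕtoℚ (a !) ℚ.* Σ[ (λ K → ℕtoℚ (coef (suc a) b K) ℚ.* eComp K α) ] (comps n)
      ≡⟨ Σ-homo (ℕtoℚ (a !) ℚ.*_) (ℚₚ.*-zeroʳ (ℕtoℚ (a !))) (ℚₚ.*-distribˡ-+ (ℕtoℚ (a !))) (λ K → ℕtoℚ (coef (suc a) b K) ℚ.* eComp K α) (comps n) ⟩
    Σ[ (λ K → ℕtoℚ (a !) ℚ.* (ℕtoℚ (coef (suc a) b K) ℚ.* eComp K α)) ] (comps n)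
      ≡⟨ Σ-cong (λ K → trans (sym (ℚₚ.*-assoc (ℕtoℚ (a !)) _ _)) (cong (ℚ._* eComp K α) (sym (ℕtoℚ-* (a !) (coef (suc a) b K))))) (comps n) ⟩
    Σ[ (λ K → q K ℚ.* eComp K α) ] (comps n)
      ≡⟨ Σ-collect n q α ⟨
    Σ[ (λ μ → collect n q μ ℚ.* eComp μ α) ] (partitions n) ∎
    where open ≡-Reasoning
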